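{- Let $q$ be a prime power, and let $r$ and $t$ be positive integers. Let $\gamma$ be a primitive element of $\mathbb{F}_{q^r}$, and let $\bar\varphi$, $P_\ell$, $Q_{\ell,m,i}$ be as defined in the context. For each pair of integers $(\ell,m)$ with $1\le \ell<m\le t$, let $j_{\ell,m},i_{\ell,m}\in\{1,\dots,q^r-1\}$ be integers with the following property: for all $s>1$ dividing $r$, $j_{\ell,m}-i_{\ell,m}\not\equiv 0\bmod\big(\frac{q^s-1}{q-1}\big)$. Define $$\mathcal{T}:=\Big(\bigcup_{1\le \ell\le t}\bar\varphi(P_\ell)\Big)\cup\Big(\bigcup_{1\le\ell<m\le t}\big(\bar\varphi(Q_{\ell,m,i_{\ell,m}})\cup\bar\varphi(Q_{\ell,m,j_{\ell,m}})\big)\Big)\subseteq\mathbb{F}_q^{rt}.$$ Then the projectivization of $\mathcal{T}$ is a cutting blocking set in $\mathrm{PG}(rt-1,q)$.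
   Context: $\mathrm{PG}(N,q)$ is the projective space $(\mathbb{F}_q^{N+1}\setminus\{0\})/\!\sim$, with $\sim$ proportionality; vectors are row vectors. A set $\mathcal{M}\subseteq\mathrm{PG}(N,q)$ is a cutting blocking set if $\langle\mathcal{M}\cap H\rangle=H$ for every hyperplane $H$ of $\mathrm{PG}(N,q)$, where $\langle\cdot\rangle$ is the projective span. The projectivization of a union $\mathcal{T}$ of linear subspaces is the set of points $[v]$ with $0\ne v\in\mathcal{T}$. Field reduction: let $M\in\mathbb{F}_q^{r\times r}$ be the companion matrix of the minimal polynomial over $\mathbb{F}_q$ of the primitive element $\gamma$ (a generator of $\mathbb{F}_{q^r}^*$), and let $\phi:\mathbb{F}_{q^r}\to\mathbb{F}_q[M]$ be the $\mathbb{F}_q$-algebra isomorphism with $\phi(\gamma)=M$. Define $\varphi:\mathbb{F}_{q^r}^t\to\mathbb{F}_q^{r\times rt}$ by $\varphi(v_1,\dots,v_t)=(\phi(v_1)\mid\cdots\mid\phi(v_t))$, and for a point $P=[v]\in\mathrm{PG}(t-1,q^r)$ let $\bar\varphi(P)=\mathrm{rowsp}(\varphi(v))$, the $\mathbb{F}_q$-row space, an $r$-dimensional subspace of $\mathbb{F}_q^{rt}$ that does not depend on the representative $v$. With $e_1,\dots,e_t$ the standard basis vectors of $\mathbb{F}_{q^r}^t$, put $P_\ell=[e_\ell]$ for $1\le\ell\le t$ and $Q_{\ell,m,i}=[e_\ell+\gamma^i e_m]$ for $1\le\ell<m\le t$ and $1\le i\le q^r-1$.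
   Formalization: The formal theorem assumes r > 1: for r = 1 the condition on j−i is vacuous and the claim is false (e.g. t = 2, q = 4: at most 4 of the 5 points of PG(1,4) are covered, but all are needed); sporadic true cases with r = 1 (t = 1; q = 2; q = 3, i ≠ j) are dropped. -}

module Defs where

open import Algebra.Bundles using (CommutativeRing; RawRing)
open import Algebra.Morphism.Structures using (IsRingHomomorphism; IsRingMonomorphism)
import Algebra.Definitions.RawSemiring as RawSemiringDefs
open import Data.Empty using (⊥-elim)
open import Data.Fin.Base as Fin using (Fin; toℕ)
import Data.Fin.Properties as Fin
open import Data.Integer.Base as ℤ using (ℤ; +_)
import Data.Integer.Divisibility as ℤ
open import Data.Nat.Base as ℕ using (ℕ; zero; suc; NonZero; NonTrivial; >-nonZero)
import Data.Nat.DivMod as ℕ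
import Data.Nat.Divisibility as ℕ
import Data.Nat.Properties as ℕ
open import Data.Nat.Primality using (Prime; prime⇒nonTrivial)
open import Data.Product.Base using (Σ; ∃; ∃-syntax; Σ-syntax; _×_; _,_)
open import Data.Sum.Base using (_⊎_)
open import Data.Vec.Functional using (Vector; concat)
open import Data.Vec.Functional.Relation.Binary.Pointwise using (Pointwise)
open import Function.Bundles using (Inverse)
open import Level using (Level; _⊔_) renaming (suc to lsuc)
open import Relation.Binary.PropositionalEquality as ≡ using (_≡_)
open import Relation.Nullary using (¬_; yes; no)
open import Relation.Unary using (Pred; _∈_; _∩_; _≐_)

------------------------------------------------------------------------
-- Arithmetic of q

IsPrimePower : ℕ → Set
IsPrimePower q = ∃[ p ] ∃[ k ] Prime p × 1 ℕ.≤ k × q ≡ p ℕ.^ k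

primePower⇒q-1-nonZero : ∀ {q} → IsPrimePower q → NonZero (q ℕ.∸ 1)
primePower⇒q-1-nonZero (p , suc k , pr , _ , ≡.refl) =
  >-nonZero (ℕ.m<n⇒0<n∸m 1<p^k)
  where
  instance
    p-nonTrivial : NonTrivial p
    p-nonTrivial = prime⇒nonTrivial pr
  1<p^k : 1 ℕ.< p ℕ.^ suc k
  1<p^k = ℕ.<-≤-trans (ℕ.nonTrivial⇒n>1 p)
    (ℕ.m≤m*n p (p ℕ.^ k) {{ℕ.m^n≢0 p k {{ℕ.nonTrivial⇒nonZero p}}}})

-- (q ^ s - 1) / (q - 1); the division is exact.
[_^_-1]/[q-1] : ∀ q (s : ℕ) → IsPrimePower q → ℕ
[ q ^ s -1]/[q-1] pp = (q ℕ.^ s ℕ.∸ 1) ℕ./ (q ℕ.∸ 1)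
  where
  instance
    q-1-nonZero : NonZero (q ℕ.∸ 1)
    q-1-nonZero = primePower⇒q-1-nonZero pp

_≡_[mod_] : ℤ → ℤ → ℕ → Set
a ≡ b [mod n ] = (+ n) ℤ.∣ (a ℤ.- b)

------------------------------------------------------------------------
-- Finite fields

record FiniteField c ℓ (n : ℕ) : Set (lsuc (c ⊔ ℓ)) where
  field
    commutativeRing : CommutativeRing c ℓ

  open CommutativeRing commutativeRing public

  field
    1≉0      : ¬ 1# ≈ 0#
    inverse  : ∀ x → ¬ x ≈ 0# → ∃[ y ] x * y ≈ 1#
    -- exactly n elements up to _≈_
    enumeration : Inverse setoid (≡.setoid (Fin n))

  open RawSemiringDefs (RawRing.rawSemiring rawRing) public using (_^_; sum)

------------------------------------------------------------------------
-- Row vectors and matrices; an m × n matrix is a vector of m rows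

module LinearAlgebra {c ℓ} (R : CommutativeRing c ℓ) where
  open CommutativeRing R
  open RawSemiringDefs (RawRing.rawSemiring rawRing) using (sum)

  Matrix : ℕ → ℕ → Set c
  Matrix m n = Vector (Vector Carrier n) m

  infix 4 _≋_ _≋ᴹ_
  _≋_ : ∀ {n} → Vector Carrier n → Vector Carrier n → Set ℓ
  _≋_ = Pointwise _≈_

  _≋ᴹ_ : ∀ {m n} → Matrix m n → Matrix m n → Set ℓ
  _≋ᴹ_ = Pointwise _≋_

  0ᵛ : ∀ {n} → Vector Carrier n
  0ᵛ _ = 0#

  infixl 6 _+ᵛ_
  _+ᵛ_ : ∀ {n} → Vector Carrier n → Vector Carrier n → Vector Carrier n
  (u +ᵛ v) k = u k + v k

  infixr 7 _•ᵛ_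
  _•ᵛ_ : ∀ {n} → Carrier → Vector Carrier n → Vector Carrier n
  (a •ᵛ v) k = a * v k

  e : ∀ {n} → Fin n → Vector Carrier n
  e l k with l Fin.≟ k
  ... | yes _ = 1#
  ... | no  _ = 0#

  infixl 7 _·ᴹ_ _*ᴹ_
  -- row vector times matrix
  _·ᴹ_ : ∀ {m n} → Vector Carrier m → Matrix m n → Vector Carrier n
  (x ·ᴹ A) k = sum (λ i → x i * A i k)

  _*ᴹ_ : ∀ {l m n} → Matrix l m → Matrix m n → Matrix l n
  (A *ᴹ B) i = A i ·ᴹ B

  1ᴹ : ∀ {n} → Matrix n n
  1ᴹ = e

  infixr 7 _•ᴹ_
  _•ᴹ_ : ∀ {m n} → Carrier → Matrix m n → Matrix m n
  (a •ᴹ A) i = a •ᵛ A i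

  matrixRawRing : ℕ → RawRing c ℓ
  matrixRawRing n = record
    { Carrier = Matrix n n
    ; _≈_     = _≋ᴹ_
    ; _+_     = λ A B i → A i +ᵛ B i
    ; _*_     = _*ᴹ_
    ; -_      = λ A i k → - A i k
    ; 0#      = λ _ → 0ᵛ
    ; 1#      = 1ᴹ
    }

  -- The subalgebra R[M] of polynomial expressions in M.
  Polynomials : ∀ {n} → Matrix n n → Pred (Matrix n n) (c ⊔ ℓ)
  Polynomials {n} M A =
    ∃[ d ] Σ[ a ∈ Vector Carrier d ] A ≋ᴹ sumᴹ (λ i → a i •ᴹ (M ^ᴹ toℕ i))
    where
    open RawSemiringDefs (RawRing.rawSemiring (matrixRawRing n))
      renaming (sum to sumᴹ; _^_ to _^ᴹ_)

  -- Row space; also used as the span of a finite family of vectors.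
  rowsp : ∀ {m n} → Matrix m n → Pred (Vector Carrier n) (c ⊔ ℓ)
  rowsp {m} A v = Σ[ x ∈ Vector Carrier m ] v ≋ x ·ᴹ A

  LinearlyIndependent : ∀ {m n} → Matrix m n → Set (c ⊔ ℓ)
  LinearlyIndependent A = ∀ x → x ·ᴹ A ≋ 0ᵛ → x ≋ 0ᵛ

  -- A vector f of length d stands for the monic polynomial
  -- X^d + f_{d-1} X^{d-1} + ... + f_0.  Its companion matrix has ones on the
  -- superdiagonal and last row (-f_0, ..., -f_{d-1}), so that on row vectors
  -- e_i M = e_{i+1} for i < d-1.
  companion : ∀ {d} → Vector Carrier d → Matrix d d
  companion {d} f i k with suc (toℕ i) ℕ.≟ d | toℕ k ℕ.≟ suc (toℕ i)
  ... | yes _ | _     = - f k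
  ... | no  _ | yes _ = 1#
  ... | no  _ | no  _ = 0#

------------------------------------------------------------------------
-- Projective geometry.  PG n is indexed by the dimension of the underlying
-- vector space: it is PG(n-1, q).

module Projective {c ℓ q} (F : FiniteField c ℓ q) where
  open FiniteField F
  open LinearAlgebra commutativeRing

  record PG (n : ℕ) : Set (c ⊔ ℓ) where
    constructor [_,_]
    field
      rep   : Vector Carrier n
      rep≉0 : ¬ rep ≋ 0ᵛ
  open PG public

  infix 4 _∼_
  _∼_ : ∀ {n} → PG n → PG n → Set (c ⊔ ℓ)
  P ∼ Q = ∃[ a ] ¬ a ≈ 0# × rep P ≋ a •ᵛ rep Q

  projectivization : ∀ {n p} → Pred (Vector Carrier n) p → Pred (PG n) (c ⊔ ℓ ⊔ p)
  projectivization T P = ∃[ v ] Σ[ v≉0 ∈ ¬ v ≋ 0ᵛ ] v ∈ T × P ∼ [ v , v≉0 ]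

  ⟨_⟩ : ∀ {n p} → Pred (PG n) p → Pred (PG n) (c ⊔ ℓ ⊔ p)
  ⟨_⟩ {n} S P =
    ∃[ k ] Σ[ Q ∈ (Fin k → PG n) ] (∀ i → Q i ∈ S) × rep P ∈ rowsp (λ i → rep (Q i))

  IsHyperplane : ∀ {n p} → Pred (PG n) p → Set (c ⊔ ℓ ⊔ p)
  IsHyperplane {n} H =
    Σ[ B ∈ Matrix (n ℕ.∸ 1) n ] LinearlyIndependent B × H ≐ projectivization (rowsp B)

  -- Every hyperplane is extensionally equal to a predicate of level c ⊔ ℓ,
  -- so nothing is lost by fixing the level of H.
  IsCuttingBlockingSet : ∀ {n p} → Pred (PG n) p → Set (lsuc (c ⊔ ℓ) ⊔ p)
  IsCuttingBlockingSet {n} S =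
    ∀ (H : Pred (PG n) (c ⊔ ℓ)) → IsHyperplane H → ⟨ S ∩ H ⟩ ≐ H

------------------------------------------------------------------------
-- Field reduction from K, of order q ^ r, to F, of order q

module Reduction {c₁ ℓ₁ c₂ ℓ₂ q r}
  (F : FiniteField c₁ ℓ₁ q) (K : FiniteField c₂ ℓ₂ (q ℕ.^ r)) where

  private
    module F = FiniteField F
    module K = FiniteField K
    module FL = LinearAlgebra F.commutativeRing
    module KL = LinearAlgebra K.commutativeRing

  IsFieldEmbedding : (F.Carrier → K.Carrier) → Set (c₁ ⊔ ℓ₁ ⊔ ℓ₂)
  IsFieldEmbedding = IsRingHomomorphism F.rawRing K.rawRing

  -- K* is finite, so non-negative exponents suffice to generate it.
  IsPrimitive : K.Carrier → Set (c₂ ⊔ ℓ₂)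
  IsPrimitive γ = ¬ γ K.≈ K.0# × (∀ x → ¬ x K.≈ K.0# → ∃[ k ] x K.≈ γ K.^ k)

  evalMonic : (F.Carrier → K.Carrier) → ∀ {d} → Vector F.Carrier d → K.Carrier → K.Carrier
  evalMonic ι {d} f x = x K.^ d K.+ K.sum (λ i → ι (f i) K.* x K.^ toℕ i)

  IsMinimalPolynomial : (F.Carrier → K.Carrier) → K.Carrier →
                        ∀ {d} → Vector F.Carrier d → Set (c₁ ⊔ ℓ₂)
  IsMinimalPolynomial ι γ {d} f =
    evalMonic ι f γ K.≈ K.0# ×
    (∀ {n} (g : Vector F.Carrier n) → evalMonic ι g γ K.≈ K.0# → d ℕ.≤ n)

  -- φ is an isomorphism of F-algebras from K onto F[M].
  record IsAlgebraIsomorphism (ι : F.Carrier → K.Carrier) (M : FL.Matrix r r)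
           (φ : K.Carrier → FL.Matrix r r) : Set (c₁ ⊔ ℓ₁ ⊔ c₂ ⊔ ℓ₂) where
    field
      isRingMonomorphism : IsRingMonomorphism K.rawRing (FL.matrixRawRing r) φ
      linear : ∀ a x → φ (ι a K.* x) FL.≋ᴹ a FL.•ᴹ φ x
      image  : (λ A → ∃[ x ] A FL.≋ᴹ φ x) ≐ FL.Polynomials M

  module PK = Projective K
  module PF = Projective F

  module _ (φ : K.Carrier → FL.Matrix r r) where

    -- (φ v₁ ∣ ⋯ ∣ φ v_t)
    φᵗ : ∀ {t} → Vector K.Carrier t → FL.Matrix r (t ℕ.* r)
    φᵗ v a = concat (λ l → φ (v l) a)

    φ̄ : ∀ {t} → PK.PG t → Pred (Vector F.Carrier (t ℕ.* r)) (c₁ ⊔ ℓ₁)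
    φ̄ P = FL.rowsp (φᵗ (PK.rep P))

  private
    e-diagonal : ∀ {t} (l : Fin t) → KL.e l l ≡ K.1#
    e-diagonal l with l Fin.≟ l
    ... | yes _  = ≡.refl
    ... | no l≢l = ⊥-elim (l≢l ≡.refl)

    e-off-diagonal : ∀ {t} {l m : Fin t} → ¬ m ≡ l → KL.e m l ≡ K.0#
    e-off-diagonal {l = l} {m} m≢l with m Fin.≟ l
    ... | yes m≡l = ⊥-elim (m≢l m≡l)
    ... | no _    = ≡.refl

  P[_] : ∀ {t} → Fin t → PK.PG t
  P[ l ] = PK.[ KL.e l , (λ e≈0 → K.1≉0 (≡.subst (K._≈ K.0#) (e-diagonal l) (e≈0 l))) ]

  Q : K.Carrier → ∀ {t} (l m : Fin t) → l Fin.< m → ℕ → PK.PG t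
  Q γ l m l<m i = PK.[ v , (λ v≈0 → K.1≉0 (K.trans (K.sym v[l]≈1) (v≈0 l))) ]
    where
    v : Vector K.Carrier _
    v = KL.e l KL.+ᵛ (γ K.^ i) KL.•ᵛ KL.e m
    v[l]≈1 : v l K.≈ K.1#
    v[l]≈1 = K.trans
      (K.+-cong (K.reflexive (e-diagonal l))
        (K.trans
          (K.*-congˡ (K.reflexive (e-off-diagonal λ m≡l → Fin.<⇒≢ l<m (≡.sym m≡l))))
          (K.zeroʳ _)))
      (K.+-identityʳ _)

  -- Only the values i l m and j l m with l < m are used.
  𝒯 : (φ : K.Carrier → FL.Matrix r r) (γ : K.Carrier) →
      ∀ {t} (i j : Fin t → Fin t → ℕ) → Pred (Vector F.Carrier (t ℕ.* r)) (c₁ ⊔ ℓ₁)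
  𝒯 φ γ {t} i j v =
    (Σ[ l ∈ Fin t ] v ∈ φ̄ φ P[ l ]) ⊎
    (Σ[ l ∈ Fin t ] Σ[ m ∈ Fin t ] Σ[ l<m ∈ l Fin.< m ]
      (v ∈ φ̄ φ (Q γ l m l<m (i l m)) ⊎ v ∈ φ̄ φ (Q γ l m l<m (j l m))))

{-# OPTIONS --safe #-}

-- Write PG(rt - 1, q) as the points of (F^r)^t and let λ be a linear form with
-- kernel the hyperplane H, with components λ_l : F^r → F.  Then 𝒯 contains all
-- vectors supported on one block, so H is spanned by 𝒯 ∩ H as soon as, whenever
-- λ_l and λ_m are nonzero, some vector of 𝒯 ∩ H supported on the blocks l and m
-- has a component outside ker λ_l.  If none of the vectors coming from
-- Q_{l,m,i} and Q_{l,m,j} does, then both λ_m ∘ φ(γ^i) and λ_m ∘ φ(γ^j) are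
-- nonzero multiples of λ_l, so γ^i and γ^j are proportional over F.  By Fermat
-- γ^{i(q-1)} = γ^{j(q-1)}, so (q^r - 1)/(q - 1) divides j - i, contradicting the
-- hypothesis for s = r.  Bases and membership tests come from finiteness: an
-- injective linear endomorphism of F^n is surjective by counting.

module Submission where

open import Defs
open import Algebra.Bundles using (CommutativeRing)
open import Algebra.Morphism.Structures using (IsRingHomomorphism; IsRingMonomorphism)
import Algebra.Properties.CommutativeMonoid.Sum as CommutativeMonoidSum
import Algebra.Properties.CommutativeSemigroup as CommutativeSemigroupProperties
import Algebra.Properties.CommutativeSemiring.Exp as Exp
import Algebra.Properties.Ring as RingProperties
import Algebra.Properties.Semiring.Sum as SemiringSum
open import Data.Fin.Base as Fin
  using (Fin; zero; suc; toℕ; fromℕ<; punchIn; punchOut; finToFun; funToFin; combine; quotRem)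
open import Data.Fin.Permutation using (Permutation′; permutation)
import Data.Fin.Properties as Fin
open import Data.Integer.Base as ℤ using (+_)
import Data.Integer.Properties as ℤ
open import Data.Nat.Base as ℕ using (ℕ; zero; suc; _≤_; _<_; _∸_)
import Data.Nat.DivMod as ℕ
open import Data.Nat.Divisibility as ℕ using (_∣_; divides)
import Data.Nat.Properties as ℕ
open import Data.Product.Base using (∃; ∃-syntax; Σ-syntax; _×_; _,_; proj₁; proj₂)
open import Data.Sum.Base using (_⊎_; inj₁; inj₂)
open import Data.Vec.Functional using (Vector; _∷_; replicate; concat)
open import Function.Base using (_∘_)
open import Function.Bundles using (Inverse)
open import Function.Definitions using (Injective)
open import Level using (_⊔_)
open import Relation.Binary.Definitions using (Decidable; tri<; tri≈; tri>)
open import Relation.Binary.PropositionalEquality as ≡ using (_≡_; _≢_)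
import Relation.Binary.Reasoning.Setoid as SetoidReasoning
open import Relation.Nullary using (¬_; Dec; yes; no; contradiction)
open import Relation.Nullary.Decidable using (map′; ¬?; _×-dec_; decidable-stable)
open import Relation.Unary using (Pred; _∈_; _∉_; _∩_; _≐_)
import Relation.Unary as Unary

-- Counting on finite sets

injective⇒surjective : ∀ {n} {f : Fin n → Fin n} → Injective _≡_ _≡_ f → ∀ y → ∃[ x ] f x ≡ y
injective⇒surjective {suc n} {f} inj y with Fin.any? (λ x → f x Fin.≟ y)
... | yes hit = hit
-- A missed `y` could be punched out of the codomain, which would embed `Fin (suc n)` into `Fin n`.
... | no miss = contradiction (λ {x x′} → avoid-injective {x} {x′}) (Fin.<⇒notInjective ℕ.≤-refl)
  where
  y≢f : ∀ x → y ≢ f x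
  y≢f x y≡fx = miss (x , ≡.sym y≡fx)
  avoid : Fin (suc n) → Fin n
  avoid x = punchOut (y≢f x)
  avoid-injective : Injective _≡_ _≡_ avoid
  avoid-injective {x} {x′} eq = inj (Fin.punchOut-injective (y≢f x) (y≢f x′) eq)

-- Finite fields: Fermat's little theorem and powers of a primitive element

module FieldProperties {c ℓ n} (K : FiniteField c ℓ n) where
  open FiniteField K hiding (zero)
  open RingProperties ring public
    using (-‿distribˡ-*; -‿distribʳ-*; x∙y⁻¹≈ε⇒x≈y; +-inverseˡ-unique; +-cancelˡ)
  open Exp commutativeSemiring using (^-congˡ; ^-homo-*; ^-assocʳ)
  open Inverse enumeration
    using (to; from; to-cong; from-cong; strictlyInverseˡ; strictlyInverseʳ)
  private
    module Π = CommutativeMonoidSum *-commutativeMonoid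

  open SetoidReasoning setoid

  to-injective : ∀ {x y} → to x ≡ to y → x ≈ y
  to-injective {x} {y} eq = begin
    x            ≈⟨ strictlyInverseʳ x ⟨
    from (to x)  ≈⟨ from-cong eq ⟩
    from (to y)  ≈⟨ strictlyInverseʳ y ⟩
    y            ∎

  infix 4 _≟_
  _≟_ : Decidable _≈_
  x ≟ y = map′ to-injective to-cong (to x Fin.≟ to y)

  *-cancelˡ : ∀ {x y z} → ¬ x ≈ 0# → x * y ≈ x * z → y ≈ z
  *-cancelˡ {x} {y} {z} x≉0 xy≈xz with inverse x x≉0
  ... | x⁻¹ , xx⁻¹≈1 = begin
    y               ≈⟨ undo y ⟨
    x⁻¹ * (x * y)   ≈⟨ *-congˡ xy≈xz ⟩
    x⁻¹ * (x * z)   ≈⟨ undo z ⟩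
    z               ∎
    where
    undo : ∀ w → x⁻¹ * (x * w) ≈ w
    undo w = begin
      x⁻¹ * (x * w)  ≈⟨ *-assoc _ _ _ ⟨
      x⁻¹ * x * w    ≈⟨ *-congʳ (trans (*-comm _ _) xx⁻¹≈1) ⟩
      1# * w         ≈⟨ *-identityˡ w ⟩
      w              ∎

  *≉0 : ∀ {x y} → ¬ x ≈ 0# → ¬ y ≈ 0# → ¬ x * y ≈ 0#
  *≉0 x≉0 y≉0 xy≈0 = y≉0 (*-cancelˡ x≉0 (trans xy≈0 (sym (zeroʳ _))))

  ^≉0 : ∀ {x} → ¬ x ≈ 0# → ∀ m → ¬ x ^ m ≈ 0#
  ^≉0 x≉0 zero    = 1≉0
  ^≉0 x≉0 (suc m) = *≉0 x≉0 (^≉0 x≉0 m)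

  1^ : ∀ m → 1# ^ m ≈ 1#
  1^ zero    = refl
  1^ (suc m) = trans (*-identityˡ _) (1^ m)

  -- Multiplication by a permutes K, hence fixes the product of its nonzero
  -- elements, which it multiplies by a ^ (n - 1).
  module _ (a : Carrier) (a≉0 : ¬ a ≈ 0#) where
    private
      a⁻¹ : Carrier
      a⁻¹ = proj₁ (inverse a a≉0)

      -- Putting 1 in place of 0 lets the product of the nonzero elements run over the whole
      -- enumeration.
      nonzeroOr1 : Carrier → Carrier
      nonzeroOr1 x with x ≟ 0#
      ... | yes _ = 1#
      ... | no _  = x

      nonzeroOr1≉0 : ∀ x → ¬ nonzeroOr1 x ≈ 0#
      nonzeroOr1≉0 x with x ≟ 0#
      ... | yes _  = 1≉0
      ... | no x≉0 = x≉0

      -- The ratio of the values of `nonzeroOr1` at `a * x` and at `x`. The single zero contributes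
      -- 1 instead of `a`, whence the exponent `n ∸ 1`.
      factor : Carrier → Carrier
      factor x with x ≟ 0#
      ... | yes _ = 1#
      ... | no _  = a

      factor-zero : ∀ {x} → x ≈ 0# → factor x ≈ 1#
      factor-zero {x} x≈0 with x ≟ 0#
      ... | yes _  = refl
      ... | no x≉0 = contradiction x≈0 x≉0

      factor-nonzero : ∀ {x} → ¬ x ≈ 0# → factor x ≈ a
      factor-nonzero {x} x≉0 with x ≟ 0#
      ... | yes x≈0 = contradiction x≈0 x≉0
      ... | no _    = refl

      nonzeroOr1-scaled : ∀ {x y} → y ≈ a * x → nonzeroOr1 y ≈ factor x * nonzeroOr1 x
      nonzeroOr1-scaled {x} {y} y≈ax with x ≟ 0# | y ≟ 0#
      ... | yes _   | yes _   = sym (*-identityˡ 1#)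
      ... | yes x≈0 | no y≉0  = contradiction (trans y≈ax (trans (*-congˡ x≈0) (zeroʳ a))) y≉0
      ... | no x≉0  | yes y≈0 = contradiction (trans (sym y≈ax) y≈0) (*≉0 a≉0 x≉0)
      ... | no _    | no _    = y≈ax

      scale : Carrier → Fin n → Fin n
      scale b i = to (b * from i)

      scale-inverse : ∀ {b d} → b * d ≈ 1# → ∀ i → scale b (scale d i) ≡ i
      scale-inverse {b} {d} bd≈1 i = ≡.trans (to-cong (begin
        b * from (scale d i)  ≈⟨ *-congˡ (strictlyInverseʳ _) ⟩
        b * (d * from i)      ≈⟨ *-assoc _ _ _ ⟨
        b * d * from i        ≈⟨ *-congʳ bd≈1 ⟩
        1# * from i           ≈⟨ *-identityˡ _ ⟩
        from i                ∎)) (strictlyInverseˡ i)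

      aa⁻¹≈1 : a * a⁻¹ ≈ 1#
      aa⁻¹≈1 = proj₂ (inverse a a≉0)

      scaling : Permutation′ n
      scaling = permutation (scale a) (scale a⁻¹)
        (scale-inverse aa⁻¹≈1) (scale-inverse (trans (*-comm _ _) aa⁻¹≈1))

      Π-nonzero : ∀ {m} (h : Vector Carrier m) → (∀ i → ¬ h i ≈ 0#) → ¬ Π.sum h ≈ 0#
      Π-nonzero {zero}  h h≉0 = 1≉0
      Π-nonzero {suc m} h h≉0 = *≉0 (h≉0 zero) (Π-nonzero (h ∘ suc) (h≉0 ∘ suc))

      Π-factor : ∀ {m} (h : Fin m → Carrier) (i : Fin m) → h i ≈ 0# →
                 (∀ k → k ≢ i → ¬ h k ≈ 0#) → Π.sum (factor ∘ h) ≈ a ^ (m ∸ 1)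
      Π-factor {suc m} h i hᵢ≈0 h≉0 = begin
        Π.sum (factor ∘ h)
          ≈⟨ Π.sum-remove {i = i} (factor ∘ h) ⟩
        factor (h i) * Π.sum (factor ∘ h ∘ punchIn i)
          ≈⟨ *-cong (factor-zero hᵢ≈0) (Π.sum-cong-≋ λ k →
               factor-nonzero (h≉0 (punchIn i k) (Fin.punchInᵢ≢i i k))) ⟩
        1# * Π.sum (replicate m a)
          ≈⟨ *-identityˡ _ ⟩
        Π.sum (replicate m a)
          ≈⟨ Π.sum-replicate m ⟩
        a ^ m ∎

    fermat : a ^ (n ∸ 1) ≈ 1#
    fermat = *-cancelˡ (Π-nonzero (nonzeroOr1 ∘ from) (nonzeroOr1≉0 ∘ from)) (begin
      Π.sum (nonzeroOr1 ∘ from) * a ^ (n ∸ 1)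
        ≈⟨ *-comm _ _ ⟩
      a ^ (n ∸ 1) * Π.sum (nonzeroOr1 ∘ from)
        ≈⟨ *-congʳ (Π-factor from (to 0#) (strictlyInverseʳ 0#) λ k k≢0 k≈0 →
             k≢0 (≡.trans (≡.sym (strictlyInverseˡ k)) (to-cong k≈0))) ⟨
      Π.sum (factor ∘ from) * Π.sum (nonzeroOr1 ∘ from)
        ≈⟨ Π.∑-distrib-+ (factor ∘ from) (nonzeroOr1 ∘ from) ⟨
      Π.sum (λ i → factor (from i) * nonzeroOr1 (from i))
        ≈⟨ Π.sum-cong-≋ {n} (λ i → nonzeroOr1-scaled {from i} (strictlyInverseʳ _)) ⟨
      Π.sum (λ i → nonzeroOr1 (from (scale a i)))
        ≈⟨ Π.sum-permute (nonzeroOr1 ∘ from) scaling ⟨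
      Π.sum (nonzeroOr1 ∘ from)
        ≈⟨ *-identityʳ _ ⟨
      Π.sum (nonzeroOr1 ∘ from) * 1# ∎)

  module _ (γ : Carrier) (γ≉0 : ¬ γ ≈ 0#)
           (generates : ∀ x → ¬ x ≈ 0# → ∃[ k ] x ≈ γ ^ k) where

    ^-% : ∀ {m} .{{_ : ℕ.NonZero m}} → γ ^ m ≈ 1# → ∀ k → γ ^ k ≈ γ ^ (k ℕ.% m)
    ^-% {m} γᵐ≈1 k = begin
      γ ^ k
        ≡⟨ ≡.cong (γ ^_) (ℕ.m≡m%n+[m/n]*n k m) ⟩
      γ ^ (k ℕ.% m ℕ.+ k ℕ./ m ℕ.* m)
        ≈⟨ ^-homo-* γ (k ℕ.% m) _ ⟩
      γ ^ (k ℕ.% m) * γ ^ (k ℕ./ m ℕ.* m)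
        ≡⟨ ≡.cong (λ j → γ ^ (k ℕ.% m) * γ ^ j) (ℕ.*-comm (k ℕ./ m) m) ⟩
      γ ^ (k ℕ.% m) * γ ^ (m ℕ.* (k ℕ./ m))
        ≈⟨ *-congˡ (^-assocʳ γ m _) ⟨
      γ ^ (k ℕ.% m) * (γ ^ m) ^ (k ℕ./ m)
        ≈⟨ *-congˡ (trans (^-congˡ (k ℕ./ m) γᵐ≈1) (1^ (k ℕ./ m))) ⟩
      γ ^ (k ℕ.% m) * 1#
        ≈⟨ *-identityʳ _ ⟩
      γ ^ (k ℕ.% m) ∎

    -- Every element of K is 0 or one of the powers γ ^ k with k < m.
    order-minimal : ∀ m .{{_ : ℕ.NonZero m}} → γ ^ m ≈ 1# → n ≤ suc m
    order-minimal m γᵐ≈1 = Fin.injective⇒≤ {f = proj₁ ∘ code ∘ from} λ {i} {j} eq → code-injective i j eq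
      where
      value : Fin (suc m) → Carrier
      value zero    = 0#
      value (suc k) = γ ^ toℕ k

      code : ∀ x → ∃[ k ] x ≈ value k
      code x with x ≟ 0#
      ... | yes x≈0 = zero , x≈0
      ... | no x≉0 with generates x x≉0
      ...   | k , x≈γᵏ = suc (fromℕ< (ℕ.m%n<n k m)) , (begin
        x                                    ≈⟨ x≈γᵏ ⟩
        γ ^ k                               ≈⟨ ^-% γᵐ≈1 k ⟩
        γ ^ (k ℕ.% m)                       ≡⟨ ≡.cong (γ ^_) (Fin.toℕ-fromℕ< (ℕ.m%n<n k m)) ⟨
        γ ^ toℕ (fromℕ< (ℕ.m%n<n k m))      ∎)

      code-injective : ∀ i j → proj₁ (code (from i)) ≡ proj₁ (code (from j)) → i ≡ j
      code-injective i j eq = ≡.trans (≡.sym (strictlyInverseˡ i)) (≡.trans (to-cong (begin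
        from i                          ≈⟨ proj₂ (code (from i)) ⟩
        value (proj₁ (code (from i)))   ≡⟨ ≡.cong value eq ⟩
        value (proj₁ (code (from j)))   ≈⟨ proj₂ (code (from j)) ⟨
        from j                          ∎)) (strictlyInverseˡ j))

    -- By `fermat` the exponent can be reduced modulo `n ∸ 1`; a nonzero remainder would be a
    -- positive exponent too small for `order-minimal`.
    order-∣ : ∀ m → γ ^ m ≈ 1# → n ∸ 1 ∣ m
    order-∣ m γᵐ≈1 with n ∸ 1 in n-1≡N | fermat γ γ≉0
    -- If `n ∸ 1` were 0, all elements would have the same index, and 1 would equal 0.
    ... | zero  | _ = contradiction
      (to-injective (Fin.≤-antisym (bound 1# 0#) (bound 0# 1#))) 1≉0
      where
      bound : ∀ x y → to x Fin.≤ to y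
      bound x y = ℕ.≤-trans (ℕ.≤-trans (ℕ.∸-monoˡ-≤ 1 (Fin.toℕ<n (to x))) (ℕ.≤-reflexive n-1≡N)) ℕ.z≤n
    ... | suc N | γᴺ≈1 with m ℕ.% suc N in eq
    ...   | zero = ℕ.m%n≡0⇒n∣m m (suc N) eq
    ...   | suc k = contradiction
      (ℕ.≤-trans (ℕ.≤-reflexive (≡.sym n-1≡N)) (ℕ.∸-monoˡ-≤ 1 (order-minimal (suc k) γ^k≈1)))
      (ℕ.<⇒≱ (≡.subst (_< suc N) eq (ℕ.m%n<n m (suc N))))
      where
      γ^k≈1 : γ ^ suc k ≈ 1#
      γ^k≈1 = begin
        γ ^ suc k          ≡⟨ ≡.cong (γ ^_) eq ⟨
        γ ^ (m ℕ.% suc N)  ≈⟨ ^-% γᴺ≈1 m ⟨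
        γ ^ m              ≈⟨ γᵐ≈1 ⟩
        1#                  ∎

    ^-injective-≤ : ∀ {a b} → a ≤ b → γ ^ a ≈ γ ^ b → n ∸ 1 ∣ b ∸ a
    ^-injective-≤ {a} {b} a≤b γᵃ≈γᵇ = order-∣ (b ∸ a) (*-cancelˡ (^≉0 γ≉0 a) (begin
      γ ^ a * γ ^ (b ∸ a)   ≈⟨ ^-homo-* γ a (b ∸ a) ⟨
      γ ^ (a ℕ.+ (b ∸ a))    ≡⟨ ≡.cong (γ ^_) (ℕ.m+[n∸m]≡n a≤b) ⟩
      γ ^ b                  ≈⟨ γᵃ≈γᵇ ⟨
      γ ^ a                  ≈⟨ *-identityʳ _ ⟨
      γ ^ a * 1#             ∎))

    ^-injective-mod : ∀ a b → γ ^ a ≈ γ ^ b → n ∸ 1 ∣ ℕ.∣ a - b ∣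
    ^-injective-mod a b γᵃ≈γᵇ with ℕ.≤-total a b
    ... | inj₁ a≤b = ≡.subst (n ∸ 1 ∣_) (≡.sym (ℕ.m≤n⇒∣m-n∣≡n∸m a≤b)) (^-injective-≤ a≤b γᵃ≈γᵇ)
    ... | inj₂ b≤a = ≡.subst (n ∸ 1 ∣_) (≡.sym (ℕ.m≤n⇒∣n-m∣≡n∸m b≤a)) (^-injective-≤ b≤a (sym γᵃ≈γᵇ))

-- Row vectors, linear forms and subspaces over a commutative ring

module LinearAlgebraProperties {c ℓ} (R : CommutativeRing c ℓ) where
  open CommutativeRing R hiding (zero)
  open LinearAlgebra R
  open SemiringSum semiring
  open CommutativeSemigroupProperties *-commutativeSemigroup using (x∙yz≈y∙xz)
  open SetoidReasoning setoid

  sum-zero : ∀ {n} (x : Vector Carrier n) → x ≋ 0ᵛ → sum x ≈ 0#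
  sum-zero {n} x x≋0 = trans (sum-cong-≋ x≋0) (sum-replicate-zero n)

  ·ᴹ-cong : ∀ {m n} {x y : Vector Carrier m} {A B : Matrix m n} →
            x ≋ y → A ≋ᴹ B → x ·ᴹ A ≋ y ·ᴹ B
  ·ᴹ-cong x≋y A≋B k = sum-cong-≋ λ i → *-cong (x≋y i) (A≋B i k)

  ·ᴹ-congˡ : ∀ {m n} {x y : Vector Carrier m} (A : Matrix m n) → x ≋ y → x ·ᴹ A ≋ y ·ᴹ A
  ·ᴹ-congˡ A x≋y = ·ᴹ-cong {A = A} x≋y (λ _ _ → refl)

  ·ᴹ-congʳ : ∀ {m n} (x : Vector Carrier m) {A B : Matrix m n} → A ≋ᴹ B → x ·ᴹ A ≋ x ·ᴹ B
  ·ᴹ-congʳ x {A} {B} A≋B = ·ᴹ-cong {x = x} {A = A} {B} (λ _ → refl) A≋B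

  ·ᴹ-distribʳ-+ : ∀ {m n} (x y : Vector Carrier m) (A : Matrix m n) →
                  (x +ᵛ y) ·ᴹ A ≋ (x ·ᴹ A) +ᵛ (y ·ᴹ A)
  ·ᴹ-distribʳ-+ x y A k = trans
    (sum-cong-≋ λ i → distribʳ (A i k) (x i) (y i))
    (∑-distrib-+ (λ i → x i * A i k) (λ i → y i * A i k))

  ·ᴹ-distribˡ-+ : ∀ {m n} (x : Vector Carrier m) (A B : Matrix m n) →
                  x ·ᴹ (λ i → A i +ᵛ B i) ≋ (x ·ᴹ A) +ᵛ (x ·ᴹ B)
  ·ᴹ-distribˡ-+ x A B k = trans
    (sum-cong-≋ λ i → distribˡ (x i) (A i k) (B i k))
    (∑-distrib-+ (λ i → x i * A i k) (λ i → x i * B i k))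

  •-·ᴹ-assoc : ∀ {m n} a (x : Vector Carrier m) (A : Matrix m n) →
               (a •ᵛ x) ·ᴹ A ≋ a •ᵛ (x ·ᴹ A)
  •-·ᴹ-assoc a x A k = trans
    (sum-cong-≋ λ i → *-assoc a (x i) (A i k))
    (sym (*-distribˡ-sum a (λ i → x i * A i k)))

  ·ᴹ-•ᴹ : ∀ {m n} a (x : Vector Carrier m) (A : Matrix m n) →
          x ·ᴹ (a •ᴹ A) ≋ a •ᵛ (x ·ᴹ A)
  ·ᴹ-•ᴹ a x A k = trans
    (sum-cong-≋ λ i → x∙yz≈y∙xz (x i) a (A i k))
    (sym (*-distribˡ-sum a (λ i → x i * A i k)))

  ·ᴹ-zeroˡ : ∀ {m n} (A : Matrix m n) → 0ᵛ ·ᴹ A ≋ 0ᵛ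
  ·ᴹ-zeroˡ A k = sum-zero _ λ i → zeroˡ (A i k)

  ·ᴹ-zeroʳ : ∀ {m n} (x : Vector Carrier m) → x ·ᴹ (λ (_ : Fin m) → 0ᵛ {n}) ≋ 0ᵛ
  ·ᴹ-zeroʳ x k = sum-zero _ λ i → zeroʳ (x i)

  e-diagonal : ∀ {n} (l : Fin n) → e l l ≈ 1#
  e-diagonal l with l Fin.≟ l
  ... | yes _  = refl
  ... | no l≢l = contradiction ≡.refl l≢l

  e-off-diagonal : ∀ {n} {l m : Fin n} → l ≢ m → e l m ≈ 0#
  e-off-diagonal {l = l} {m} l≢m with l Fin.≟ m
  ... | yes l≡m = contradiction l≡m l≢m
  ... | no _    = refl

  ·ᴹ-identityʳ : ∀ {n} (x : Vector Carrier n) → x ·ᴹ 1ᴹ ≋ x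
  ·ᴹ-identityʳ {suc n} x k = begin
    sum (λ i → x i * e i k)
      ≈⟨ sum-remove {i = k} (λ i → x i * e i k) ⟩
    x k * e k k + sum (λ i → x (punchIn k i) * e (punchIn k i) k)
      ≈⟨ +-cong (*-congˡ (e-diagonal k)) (sum-zero _ λ i →
           trans (*-congˡ (e-off-diagonal (Fin.punchInᵢ≢i k i))) (zeroʳ _)) ⟩
    x k * 1# + 0#
      ≈⟨ trans (+-identityʳ _) (*-identityʳ _) ⟩
    x k ∎

  ·ᴹ-assoc : ∀ {l m n} (x : Vector Carrier l) (A : Matrix l m) (B : Matrix m n) →
             x ·ᴹ A ·ᴹ B ≋ x ·ᴹ (A *ᴹ B)
  ·ᴹ-assoc x A B k = begin
    sum (λ j → sum (λ i → x i * A i j) * B j k)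
      ≈⟨ sum-cong-≋ (λ j → trans (*-distribʳ-sum (B j k) (λ i → x i * A i j))
           (sum-cong-≋ λ i → *-assoc (x i) (A i j) (B j k))) ⟩
    sum (λ j → sum (λ i → x i * (A i j * B j k)))
      ≈⟨ ∑-comm (λ j i → x i * (A i j * B j k)) ⟩
    sum (λ i → sum (λ j → x i * (A i j * B j k)))
      ≈⟨ sum-cong-≋ (λ i → *-distribˡ-sum (x i) (λ j → A i j * B j k)) ⟨
    sum (λ i → x i * sum (λ j → A i j * B j k)) ∎

  rowsp-·ᴹ : ∀ {l m n} {A : Matrix l n} {B : Matrix m n} → (∀ i → A i ∈ rowsp B) →
             ∀ x → x ·ᴹ A ∈ rowsp B
  rowsp-·ᴹ {A = A} {B} A∈B x = x ·ᴹ Y , λ k → trans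
    (·ᴹ-congʳ x (λ i → proj₂ (A∈B i)) k)
    (sym (·ᴹ-assoc x Y B k))
    where
    Y : Matrix _ _
    Y i = proj₁ (A∈B i)

  -- Forms are functions rather than coefficient vectors, because they arise as a coordinate in a
  -- basis and are then composed with matrices and block embeddings.
  record IsLinearForm {n} (p : Vector Carrier n → Carrier) : Set (c ⊔ ℓ) where
    field
      cong   : ∀ {x y} → x ≋ y → p x ≈ p y
      +-homo : ∀ x y → p (x +ᵛ y) ≈ p x + p y
      •-homo : ∀ a x → p (a •ᵛ x) ≈ a * p x

    -•-homo : ∀ x a y → p (x +ᵛ (- a) •ᵛ y) ≈ p x - a * p y
    -•-homo x a y = trans (+-homo x _) (+-congˡ (trans (•-homo _ y)
      (sym (RingProperties.-‿distribˡ-* ring a (p y)))))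

  ∘·ᴹ-isLinearForm : ∀ {m n} {p : Vector Carrier n → Carrier} → IsLinearForm p →
                     (A : Matrix m n) → IsLinearForm (λ x → p (x ·ᴹ A))
  ∘·ᴹ-isLinearForm {p = p} p-linear A = record
    { cong   = λ x≋y → cong (·ᴹ-congˡ A x≋y)
    ; +-homo = λ x y → trans (cong (·ᴹ-distribʳ-+ x y A)) (+-homo _ _)
    ; •-homo = λ a x → trans (cong (•-·ᴹ-assoc a x A)) (•-homo _ _)
    }
    where open IsLinearForm p-linear

  +-isLinearForm : ∀ {n} {p s : Vector Carrier n → Carrier} → IsLinearForm p → IsLinearForm s →
                   IsLinearForm (λ x → p x + s x)
  +-isLinearForm p-linear s-linear = record
    { cong   = λ x≋y → +-cong (p.cong x≋y) (s.cong x≋y)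
    ; +-homo = λ x y → trans (+-cong (p.+-homo x y) (s.+-homo x y)) (interchange _ _ _ _)
    ; •-homo = λ a x → trans (+-cong (p.•-homo a x) (s.•-homo a x)) (sym (distribˡ a _ _))
    }
    where
    module p = IsLinearForm p-linear
    module s = IsLinearForm s-linear
    open CommutativeSemigroupProperties +-commutativeSemigroup using (interchange)

  -- A subspace is a predicate, since this has to cover the span of a set of points and its
  -- extension by one vector, neither of which is given by a basis.
  record IsSubspace {n u} (U : Pred (Vector Carrier n) u) : Set (c ⊔ ℓ ⊔ u) where
    field
      resp     : ∀ {x y} → x ≋ y → x ∈ U → y ∈ U
      0ᵛ∈      : 0ᵛ ∈ U
      +-closed : ∀ {x y} → x ∈ U → y ∈ U → x +ᵛ y ∈ U
      •-closed : ∀ a {x} → x ∈ U → a •ᵛ x ∈ U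

    sum-closed : ∀ {m} (V : Matrix m n) → (∀ i → V i ∈ U) → (λ k → sum (λ i → V i k)) ∈ U
    sum-closed {zero}  V V∈U = 0ᵛ∈
    sum-closed {suc m} V V∈U = +-closed (V∈U zero) (sum-closed (V ∘ suc) (V∈U ∘ suc))

-- Vectors over a finite field: search, bases, hyperplanes as kernels

module FiniteVectors {c ℓ q} (F : FiniteField c ℓ q) where
  open FiniteField F hiding (zero; _^_)
  open LinearAlgebra commutativeRing
  open LinearAlgebraProperties commutativeRing
  open FieldProperties F
  open Inverse enumeration using (to; from; to-cong; from-cong; strictlyInverseˡ; strictlyInverseʳ)

  _≋?_ : ∀ {n} → Decidable (_≋_ {n})
  x ≋? y = Fin.all? λ i → x i ≟ y i

  private
    funToFin-cong : ∀ {m n} {f g : Fin m → Fin n} → (∀ i → f i ≡ g i) → funToFin f ≡ funToFin g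
    funToFin-cong {zero}  f≗g = ≡.refl
    funToFin-cong {suc m} f≗g = ≡.cong₂ Fin.combine (f≗g zero) (funToFin-cong (f≗g ∘ suc))

    -- Numbering the vectors by `Fin (q ℕ.^ n)` makes it possible both to search among them and to
    -- count them.
    encode : ∀ {n} → Vector Carrier n → Fin (q ℕ.^ n)
    encode x = funToFin (to ∘ x)

    decode : ∀ {n} → Fin (q ℕ.^ n) → Vector Carrier n
    decode i = from ∘ finToFun i

    decode-encode : ∀ {n} (x : Vector Carrier n) → decode (encode x) ≋ x
    decode-encode x i = trans (from-cong (Fin.finToFun-funToFin (to ∘ x) i)) (strictlyInverseʳ (x i))

    encode-decode : ∀ {n} (i : Fin (q ℕ.^ n)) → encode (decode {n} i) ≡ i
    encode-decode {n} i = ≡.trans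
      (funToFin-cong (λ k → strictlyInverseˡ (finToFun {q} {n} i k)))
      (Fin.funToFin-finToFin {n} {q} i)

    encode-injective : ∀ {n} {x y : Vector Carrier n} → encode x ≡ encode y → x ≋ y
    encode-injective {x = x} {y} eq i = trans (sym (decode-encode x i))
      (trans (≡.subst (λ j → decode (encode x) i ≈ decode j i) eq refl) (decode-encode y i))

    encode-cong : ∀ {n} {x y : Vector Carrier n} → x ≋ y → encode x ≡ encode y
    encode-cong x≋y = funToFin-cong (λ i → to-cong (x≋y i))

  anyVector? : ∀ {n p} {P : Pred (Vector Carrier n) p} → (∀ {x y} → x ≋ y → P x → P y) →
               Unary.Decidable P → Dec (∃ P)
  anyVector? {n} {P = P} resp P? = map′
    (λ { (i , Pi) → decode i , Pi })
    (λ { (x , Px) → encode x , resp (λ i → sym (decode-encode x i)) Px })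
    (Fin.any? (λ i → P? (decode {n} i)))

  rowsp? : ∀ {m n} (A : Matrix m n) → Unary.Decidable (rowsp A)
  rowsp? A v = anyVector?
    (λ x≋y v≋xA k → trans (v≋xA k) (·ᴹ-congˡ A x≋y k))
    (λ x → v ≋? (x ·ᴹ A))

  independent⇒injective : ∀ {m n} (A : Matrix m n) → LinearlyIndependent A →
                          ∀ {x y} → x ·ᴹ A ≋ y ·ᴹ A → x ≋ y
  independent⇒injective A independent {x} {y} xA≋yA i =
    x∙y⁻¹≈ε⇒x≈y _ _ (trans (+-congˡ (sym (-1*x≈-x (y i))))
     (independent (x +ᵛ (- 1#) •ᵛ y) (λ k → begin
      ((x +ᵛ (- 1#) •ᵛ y) ·ᴹ A) k           ≈⟨ ·ᴹ-distribʳ-+ x ((- 1#) •ᵛ y) A k ⟩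
      (x ·ᴹ A) k + (((- 1#) •ᵛ y) ·ᴹ A) k   ≈⟨ +-cong (xA≋yA k) (•-·ᴹ-assoc (- 1#) y A k) ⟩
      (y ·ᴹ A) k + - 1# * (y ·ᴹ A) k        ≈⟨ +-congˡ (-1*x≈-x _) ⟩
      (y ·ᴹ A) k - (y ·ᴹ A) k               ≈⟨ -‿inverseʳ _ ⟩
      0#                                    ∎) i))
    where
    open SetoidReasoning setoid
    open RingProperties ring using (-1*x≈-x)

  -- Read through the numbering, multiplication by `A` is a self-map of `Fin (q ℕ.^ n)`. It is
  -- injective by independence, so the code of `v` has a preimage, which encodes the coefficients.
  independent⇒spanning : ∀ {n} (A : Matrix n n) → LinearlyIndependent A → ∀ v → v ∈ rowsp A
  independent⇒spanning {n} A independent v =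
    let i , eq = injective⇒surjective {f = λ i → encode (decode {n} i ·ᴹ A)}
                   (λ {i} {j} eq → ≡.trans (≡.sym (encode-decode {n} i)) (≡.trans
                     (encode-cong (independent⇒injective A independent
                       (encode-injective {x = decode {n} i ·ᴹ A} {y = decode {n} j ·ᴹ A} eq)))
                     (encode-decode {n} j)))
                   (encode v)
    in decode i , λ k → sym (encode-injective {x = decode {n} i ·ᴹ A} {y = v} eq k)

  -- Completing the rows of B by g gives a basis; the form is the coordinate at g.
  hyperplaneForm : ∀ {n} {B : Matrix (n ∸ 1) n} → LinearlyIndependent B → ∀ {g} → g ∉ rowsp B →
                   ∃[ p ] IsLinearForm p × p g ≈ 1# ×
                     (∀ {v} → p v ≈ 0# → v ∈ rowsp B) × (∀ {v} → v ∈ rowsp B → p v ≈ 0#)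
  -- In dimension 0 every vector is the empty combination, so no `g` lies outside the row space.
  hyperplaneForm {zero}  {B} _ {g} g∉B = contradiction ((λ ()) , (λ ())) g∉B
  hyperplaneForm {suc n} {B} B-independent {g} g∉B =
    p
    , record
      { cong   = λ {x} {y} x≋y → unique (coords y) (λ k → trans (x≋y k) (proj₂ (spanning y) k))
      ; +-homo = λ x y → unique (coords x +ᵛ coords y) (λ k → trans
                   (+-cong (proj₂ (spanning x) k) (proj₂ (spanning y) k))
                   (sym (·ᴹ-distribʳ-+ (coords x) (coords y) A k)))
      ; •-homo = λ a x → unique (a •ᵛ coords x) (λ k → trans (*-congˡ (proj₂ (spanning x) k))
                   (sym (•-·ᴹ-assoc a (coords x) A k)))
      }
    , unique (1# ∷ 0ᵛ) (λ k → sym (trans (+-cong (*-identityˡ (g k)) (·ᴹ-zeroˡ B k)) (+-identityʳ (g k))))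
    , (λ {v} pv≈0 → coords v ∘ suc , λ k → trans (proj₂ (spanning v) k)
        (trans (+-congʳ (trans (*-congʳ pv≈0) (zeroˡ _))) (+-identityˡ _)))
    , (λ { (x , v≋xB) → unique (0# ∷ x) λ k →
        trans (v≋xB k) (sym (trans (+-congʳ (zeroˡ _)) (+-identityˡ _))) })
    where
    open SetoidReasoning setoid

    A : Matrix (suc n) (suc n)
    A = g ∷ B

    -- A nonzero coefficient at `g` could be inverted, and the relation solved for `g` in terms of
    -- the rows of `B`.
    head≈0 : ∀ x → x ·ᴹ A ≋ 0ᵛ → x zero ≈ 0#
    head≈0 x xA≋0 with x zero ≟ 0#
    ... | yes x₀≈0 = x₀≈0
    ... | no x₀≉0 with inverse (x zero) x₀≉0
    ...   | x₀⁻¹ , x₀x₀⁻¹≈1 = contradiction ((- x₀⁻¹) •ᵛ (x ∘ suc) , g≋) g∉B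
      where
      g≋ : g ≋ ((- x₀⁻¹) •ᵛ (x ∘ suc)) ·ᴹ B
      g≋ k = *-cancelˡ x₀≉0 (begin
        x zero * g k
          ≈⟨ +-inverseˡ-unique _ _ (xA≋0 k) ⟩
        - xB
          ≈⟨ *-identityˡ _ ⟨
        1# * - xB
          ≈⟨ *-congʳ x₀x₀⁻¹≈1 ⟨
        x zero * x₀⁻¹ * - xB
          ≈⟨ *-assoc _ _ _ ⟩
        x zero * (x₀⁻¹ * - xB)
          ≈⟨ *-congˡ (trans (sym (-‿distribʳ-* _ _)) (-‿distribˡ-* _ _)) ⟩
        x zero * (- x₀⁻¹ * xB)
          ≈⟨ *-congˡ (•-·ᴹ-assoc (- x₀⁻¹) (x ∘ suc) B k) ⟨
        x zero * (((- x₀⁻¹) •ᵛ (x ∘ suc)) ·ᴹ B) k ∎)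
        where
        xB : Carrier
        xB = ((x ∘ suc) ·ᴹ B) k

    A-independent : LinearlyIndependent A
    A-independent x xA≋0 zero    = head≈0 x xA≋0
    A-independent x xA≋0 (suc i) = B-independent (x ∘ suc) (λ k → begin
      ((x ∘ suc) ·ᴹ B) k                  ≈⟨ +-identityˡ _ ⟨
      0# + ((x ∘ suc) ·ᴹ B) k             ≈⟨ +-congʳ (trans (*-congʳ (head≈0 x xA≋0)) (zeroˡ _)) ⟨
      x zero * g k + ((x ∘ suc) ·ᴹ B) k   ≈⟨ xA≋0 k ⟩
      0#                                  ∎) i

    spanning : ∀ v → v ∈ rowsp A
    spanning = independent⇒spanning A A-independent

    coords : Vector Carrier (suc n) → Vector Carrier (suc n)
    coords v = proj₁ (spanning v)

    p : Vector Carrier (suc n) → Carrier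
    p v = coords v zero

    -- `p` can be computed from any representation of `v`, not only from the one that counting
    -- happens to find. Linearity and the description of the kernel follow by exhibiting suitable
    -- representations.
    unique : ∀ {v} x → v ≋ x ·ᴹ A → p v ≈ x zero
    unique {v} x v≋xA = independent⇒injective A A-independent {coords v} {x}
      (λ k → trans (sym (proj₂ (spanning v) k)) (v≋xA k)) zero

  -- If no `y` of the first kind exists, the kernel of `p + s` is contained in that of the nonzero
  -- form `p`. Then `p + s` is a multiple of `p`, and hence so is `s`. Finiteness decides between
  -- the two cases.
  proportional : ∀ {n} {p s : Vector Carrier n → Carrier} → IsLinearForm p → IsLinearForm s →
                 ∀ {y₁} → ¬ p y₁ ≈ 0# →
                 (∃[ y ] ¬ p y ≈ 0# × p y + s y ≈ 0#) ⊎ (∃[ a ] ∀ y → s y ≈ a * p y)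
  proportional {n} {p} {s} p-linear s-linear {y₁} py₁≉0 with anyVector? resp witness?
    where
    module p = IsLinearForm p-linear
    module s = IsLinearForm s-linear

    Witness : Pred (Vector Carrier n) ℓ
    Witness y = ¬ p y ≈ 0# × p y + s y ≈ 0#

    resp : ∀ {x y} → x ≋ y → Witness x → Witness y
    resp x≋y (px≉0 , px+sx≈0) =
      (λ py≈0 → px≉0 (trans (p.cong x≋y) py≈0)) ,
      trans (sym (+-cong (p.cong x≋y) (s.cong x≋y))) px+sx≈0

    witness? : Unary.Decidable Witness
    witness? y = ¬? (p y ≟ 0#) ×-dec (p y + s y ≟ 0#)
  ... | yes witness = inj₁ witness
  ... | no none     = inj₂ (s g , s≈)
    where
    open SetoidReasoning setoid
    module p = IsLinearForm p-linear
    module p+s = IsLinearForm (+-isLinearForm p-linear s-linear)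

    g : Vector Carrier n
    g = proj₁ (inverse (p y₁) py₁≉0) •ᵛ y₁

    pg≈1 : p g ≈ 1#
    pg≈1 = trans (p.•-homo _ y₁) (trans (*-comm _ _) (proj₂ (inverse (p y₁) py₁≉0)))

    -- z lies in the kernel of p + s, so there is no witness only if p z = 0.
    s≈ : ∀ y → s y ≈ s g * p y
    s≈ y = +-cancelˡ (p y) _ _ (begin
      p y + s y              ≈⟨ *-identityʳ _ ⟨
      (p y + s y) * 1#       ≈⟨ *-congˡ pg≈1 ⟨
      (p y + s y) * p g      ≈⟨ x∙y⁻¹≈ε⇒x≈y _ _ (trans
                                  (sym (trans (p.-•-homo _ _ g) (+-congʳ (p.•-homo _ y)))) pz≈0) ⟨
      (p g + s g) * p y      ≈⟨ distribʳ _ _ _ ⟩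
      p g * p y + s g * p y  ≈⟨ +-congʳ (trans (*-congʳ pg≈1) (*-identityˡ _)) ⟩
      p y + s g * p y        ∎)
      where
      z : Vector Carrier n
      z = (p g + s g) •ᵛ y +ᵛ (- (p y + s y)) •ᵛ g

      pz+sz≈0 : p z + s z ≈ 0#
      pz+sz≈0 = begin
        p z + s z                                                ≈⟨ p+s.-•-homo _ _ g ⟩
        (p ((p g + s g) •ᵛ y) + s ((p g + s g) •ᵛ y)) - (p y + s y) * (p g + s g)
                                                                 ≈⟨ +-cong (p+s.•-homo _ y) (-‿cong (*-comm _ _)) ⟩
        (p g + s g) * (p y + s y) - (p g + s g) * (p y + s y)    ≈⟨ -‿inverseʳ _ ⟩
        0#                                                       ∎

      pz≈0 : p z ≈ 0#
      pz≈0 = decidable-stable (p z ≟ 0#) λ pz≉0 → none (z , pz≉0 , pz+sz≈0)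

-- Arithmetic of (q^s - 1) / (q - 1)

∣+m-+n∣≡∣m-n∣ : ∀ m n → ℤ.∣ + m ℤ.- + n ∣ ≡ ℕ.∣ m - n ∣
∣+m-+n∣≡∣m-n∣ m n with ℕ.≤-total m n
... | inj₁ m≤n = ≡.trans (≡.cong ℤ.∣_∣ (ℤ.m-n≡m⊖n m n))
  (≡.trans (ℤ.∣⊖∣-≤ m≤n) (≡.sym (ℕ.m≤n⇒∣m-n∣≡n∸m m≤n)))
... | inj₂ n≤m = ≡.trans (≡.cong ℤ.∣_∣ (≡.trans (ℤ.m-n≡m⊖n m n) (ℤ.⊖-≥ n≤m)))
  (≡.sym (ℕ.m≤n⇒∣n-m∣≡n∸m n≤m))

-- For q = k + 1, every power of q is 1 modulo k. For q = 0 both sides are truncated to 0.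
q-1∣q^s-1 : ∀ q s → q ∸ 1 ∣ q ℕ.^ s ∸ 1
q-1∣q^s-1 zero    zero    = ℕ.∣-refl
q-1∣q^s-1 zero    (suc s) = ℕ.∣-refl
q-1∣q^s-1 (suc k) s       = let m , eq = power s in divides m (≡.cong (_∸ 1) eq)
  where
  power : ∀ s → ∃[ m ] suc k ℕ.^ s ≡ suc (m ℕ.* k)
  power zero    = 0 , ≡.refl
  power (suc s) with power s
  -- The new quotient comes from (k + 1)(m k + 1) = (m + (m k + 1)) k + 1.
  ... | m , eq rewrite eq = m ℕ.+ suc (m ℕ.* k) , ≡.cong suc (≡.trans
    (≡.cong (m ℕ.* k ℕ.+_) (ℕ.*-comm k (suc (m ℕ.* k))))
    (≡.sym (ℕ.*-distribʳ-+ k m (suc (m ℕ.* k)))))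

-- The division is exact, so multiplying the quotient by q - 1 restores q^s - 1; the nonzero factor
-- q - 1 is then cancelled on both sides.
∣-[q^s-1]/[q-1] : ∀ {q} (pp : IsPrimePower q) s d → q ℕ.^ s ∸ 1 ∣ d ℕ.* (q ∸ 1) →
                  [ q ^ s -1]/[q-1] pp ∣ d
∣-[q^s-1]/[q-1] {q} pp s d q^s-1∣ = ℕ.*-cancelʳ-∣ (q ∸ 1)
  (≡.subst (_∣ d ℕ.* (q ∸ 1)) (≡.sym (ℕ.m/n*n≡m (q-1∣q^s-1 q s))) q^s-1∣)
  where
  instance
    q-1-nonZero : ℕ.NonZero (q ∸ 1)
    q-1-nonZero = primePower⇒q-1-nonZero pp

-- Vectors made of t blocks of length r, and spanning the kernel of a form

module BlockVectors {c ℓ q} (F : FiniteField c ℓ q) (t r : ℕ) where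
  open FiniteField F hiding (zero; _^_; sum)
  open LinearAlgebra commutativeRing
  open LinearAlgebraProperties commutativeRing
  open FieldProperties F
  open SemiringSum semiring using (sum; sum-cong-≋)
  open CommutativeSemigroupProperties *-commutativeSemigroup using (x∙yz≈y∙xz)
  open SetoidReasoning setoid

  -- Scaling by a Kronecker delta instead of splitting cases makes linearity in `x` an entrywise
  -- identity, and matches the shape of `φᵗ` at a standard basis vector.
  embed :  Fin t → Vector Carrier r → Vector Carrier (t ℕ.* r)
  embed l x = concat (λ m → e l m •ᵛ x)

  block :  Vector Carrier (t ℕ.* r) → Fin t → Vector Carrier r
  block v l b = v (combine l b)

  private
    -- `quotRem` returns the position within the block first and the index of the block second.
    δ :  Fin t → Fin (t ℕ.* r) → Carrier
    δ l k = e l (proj₂ (quotRem {t} r k))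

    entry : Fin (t ℕ.* r) → Fin r
    entry k = proj₁ (quotRem {t} r k)

  embed-cong : ∀ (l : Fin t) {x y : Vector Carrier r} → x ≋ y → embed l x ≋ embed l y
  embed-cong l x≋y k = *-congˡ (x≋y (entry k))

  embed-+ : ∀ (l : Fin t) (x y : Vector Carrier r) →
            embed l (x +ᵛ y) ≋ embed l x +ᵛ embed l y
  embed-+ l x y k = distribˡ (δ l k) (x (entry k)) (y (entry k))

  embed-• : ∀ (l : Fin t) a (x : Vector Carrier r) → embed l (a •ᵛ x) ≋ a •ᵛ embed l x
  embed-• l a x k = x∙yz≈y∙xz (δ l k) a (x (entry k))

  embed-block : ∀ (v : Vector Carrier (t ℕ.* r)) →
                (λ k → sum (λ l → embed l (block v l) k)) ≋ v
  embed-block v k = begin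
    sum (λ l → e l (proj₂ lb) * v (combine l (proj₁ lb)))
      ≈⟨ sum-cong-≋ (λ l → *-comm (e l (proj₂ lb)) (v (combine l (proj₁ lb)))) ⟩
    -- With the position in the block fixed, this is a row vector times the identity matrix.
    sum (λ l → v (combine l (proj₁ lb)) * e l (proj₂ lb))
      ≈⟨ ·ᴹ-identityʳ (λ l → v (combine l (proj₁ lb))) (proj₂ lb) ⟩
    v (combine (proj₂ lb) (proj₁ lb))
      ≡⟨ ≡.cong v (Fin.combine-remQuot {t} r k) ⟩
    v k ∎
    where
    lb : Fin r × Fin t
    lb = quotRem {t} r k

  ∘embed-isLinearForm : ∀ {p : Vector Carrier (t ℕ.* r) → Carrier} → IsLinearForm p →
                        ∀ l → IsLinearForm (λ x → p (embed l x))
  ∘embed-isLinearForm p-linear l = record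
    { cong   = λ x≋y → cong (embed-cong l x≋y)
    ; +-homo = λ x y → trans (cong (embed-+ l x y)) (+-homo _ _)
    ; •-homo = λ a x → trans (cong (embed-• l a x)) (•-homo _ _)
    }
    where open IsLinearForm p-linear

  subspace-spanned : ∀ {u} {U : Pred (Vector Carrier (t ℕ.* r)) u} → IsSubspace U →
                     (∀ l x → embed l x ∈ U) → ∀ v → v ∈ U
  subspace-spanned U-subspace embed∈U v =
    resp (embed-block v) (sum-closed (λ l → embed l (block v l)) (λ l → embed∈U l (block v l)))
    where open IsSubspace U-subspace

  -- A criterion for `U` to be the whole kernel of `p`. A block vector `g` with `p g` nonzero serves
  -- as pivot: `U` together with `g` is shown to contain every block vector, hence everything.
  -- `mixed∈U` links each other block on which `p` is nonzero to the block of the pivot.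
  module _ {u} {p : Vector Carrier (t ℕ.* r) → Carrier} (p-linear : IsLinearForm p)
           {U : Pred (Vector Carrier (t ℕ.* r)) u} (U-subspace : IsSubspace U)
           (U⊆ker : ∀ {v} → v ∈ U → p v ≈ 0#)
           (block∈U : ∀ l x → p (embed l x) ≈ 0# → embed l x ∈ U)
           (mixed∈U : ∀ l m x z → l ≢ m → ¬ p (embed l x) ≈ 0# → ¬ p (embed m z) ≈ 0# →
             ∃[ x′ ] ∃[ z′ ] ¬ p (embed l x′) ≈ 0# × embed l x′ +ᵛ embed m z′ ∈ U)
           where
    private
      module p = IsLinearForm p-linear
      module U = IsSubspace U-subspace

      -- Take d = p(x) / p(y), evaluated on block `l`. The difference is then a block vector in the
      -- kernel, so `block∈U` applies.
      reduce : ∀ l y → ¬ p (embed l y) ≈ 0# → ∀ x → ∃[ d ] embed l x +ᵛ (- d) •ᵛ embed l y ∈ U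
      reduce l y py≉0 x with inverse (p (embed l y)) py≉0
      ... | w , pw≈1 = d , U.resp (λ k → trans (embed-+ l x ((- d) •ᵛ y) k) (+-congˡ (embed-• l (- d) y k)))
        (block∈U l (x +ᵛ (- d) •ᵛ y) (begin
          p (embed l (x +ᵛ (- d) •ᵛ y))
            ≈⟨ IsLinearForm.-•-homo (∘embed-isLinearForm p-linear l) x d y ⟩
          p (embed l x) - p (embed l x) * w * p (embed l y)
            ≈⟨ +-congˡ (-‿cong (trans (*-assoc _ _ _)
                 (trans (*-congˡ (trans (*-comm _ _) pw≈1)) (*-identityʳ _)))) ⟩
          p (embed l x) - p (embed l x)
            ≈⟨ -‿inverseʳ _ ⟩
          0# ∎))
        where
        d : Carrier
        d = p (embed l x) * w

      module _ (g : Vector Carrier (t ℕ.* r)) where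
        -- The sum of `U` and the line through `g`, recorded by the multiple of `g` that brings `v`
        -- into `U`.
        U+⟨g⟩ : Pred (Vector Carrier (t ℕ.* r)) (c ⊔ u)
        U+⟨g⟩ v = ∃[ a ] v +ᵛ a •ᵛ g ∈ U

        U⊆U+⟨g⟩ : ∀ {v} → v ∈ U → v ∈ U+⟨g⟩
        U⊆U+⟨g⟩ v∈U = 0# , U.resp (λ k → sym (trans (+-congˡ (zeroˡ _)) (+-identityʳ _))) v∈U

        U+⟨g⟩-subspace : IsSubspace U+⟨g⟩
        U+⟨g⟩-subspace = record
          { resp     = λ { x≋y (a , x+ag∈U) → a , U.resp (λ k → +-congʳ (x≋y k)) x+ag∈U }
          ; 0ᵛ∈      = U⊆U+⟨g⟩ U.0ᵛ∈
          ; +-closed = λ { (a , x+ag∈U) (b , y+bg∈U) → a + b , U.resp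
              (λ k → trans (interchange _ _ _ _) (+-congˡ (sym (distribʳ _ _ _))))
              (U.+-closed x+ag∈U y+bg∈U) }
          ; •-closed = λ { b (a , x+ag∈U) → b * a , U.resp
              (λ k → trans (distribˡ _ _ _) (+-congˡ (sym (*-assoc _ _ _))))
              (U.•-closed b x+ag∈U) }
          }
          where open CommutativeSemigroupProperties +-commutativeSemigroup using (interchange)

      rearrange : ∀ x y z d → x + - d * y + (d * (y + z) + - d * z) ≈ x
      rearrange x y z d = begin
        x + - d * y + (d * (y + z) + - d * z)
          ≈⟨ +-congˡ (+-congʳ (distribˡ d y z)) ⟩
        x + - d * y + (d * y + d * z + - d * z)
          ≈⟨ +-congˡ (trans (+-assoc _ _ _) (trans
               (+-congˡ (trans (+-congˡ (sym (-‿distribˡ-* d z))) (-‿inverseʳ _))) (+-identityʳ _))) ⟩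
        x + - d * y + d * y
          ≈⟨ trans (+-assoc _ _ _) (+-congˡ (trans (+-congʳ (sym (-‿distribˡ-* d y))) (-‿inverseˡ _))) ⟩
        x + 0#
          ≈⟨ +-identityʳ x ⟩
        x ∎

    module _ (l₀ : Fin t) (x₀ : Vector Carrier r) (pg≉0 : ¬ p (embed l₀ x₀) ≈ 0#) where
      private
        g : Vector Carrier (t ℕ.* r)
        g = embed l₀ x₀

        module U+⟨g⟩ = IsSubspace (U+⟨g⟩-subspace g)

        pivot∈U+⟨g⟩ : ∀ x → U+⟨g⟩ g (embed l₀ x)
        pivot∈U+⟨g⟩ x = let d , reduced = reduce l₀ x₀ pg≉0 x in - d , reduced

        -- Write x = (x - d y) + d (y + z) - d z, with x and y in block `l` and z in block `l₀`. The
        -- first term is in `U` by `reduce`, the second by assumption, and the third lies in the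
        -- block of the pivot.
        mixed∈U⇒∈U+⟨g⟩ : ∀ l y z → ¬ p (embed l y) ≈ 0# → embed l y +ᵛ embed l₀ z ∈ U →
                         ∀ x → U+⟨g⟩ g (embed l x)
        mixed∈U⇒∈U+⟨g⟩ l y z py≉0 mixed x =
          let d , reduced = reduce l y py≉0 x in U+⟨g⟩.resp
            (λ k → rearrange (embed l x k) (embed l y k) (embed l₀ z k) d)
            (U+⟨g⟩.+-closed (U⊆U+⟨g⟩ g reduced)
              (U+⟨g⟩.+-closed (U⊆U+⟨g⟩ g (U.•-closed d mixed)) (U+⟨g⟩.•-closed (- d) (pivot∈U+⟨g⟩ z))))

        embed∈U+⟨g⟩ : ∀ l x → Dec (p (embed l x) ≈ 0#) → Dec (l ≡ l₀) → U+⟨g⟩ g (embed l x)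
        embed∈U+⟨g⟩ l x (yes px≈0) _            = U⊆U+⟨g⟩ g (block∈U l x px≈0)
        embed∈U+⟨g⟩ l x (no _)     (yes ≡.refl) = pivot∈U+⟨g⟩ x
        embed∈U+⟨g⟩ l x (no px≉0)  (no l≢l₀)    =
          let y , z , py≉0 , mixed = mixed∈U l l₀ x x₀ l≢l₀ px≉0 pg≉0 in mixed∈U⇒∈U+⟨g⟩ l y z py≉0 mixed x

      -- Some v + a g lies in `U`, hence in the kernel of `p`. As p(v) = 0 and p(g) is nonzero, a =
      -- 0 and `v` itself is in `U`.
      kernel-spanned : ∀ {v} → p v ≈ 0# → v ∈ U
      kernel-spanned {v} pv≈0 = U.resp
        (λ k → trans (+-congˡ (trans (*-congʳ a≈0) (zeroˡ _))) (+-identityʳ _)) v+ag∈U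
        where
        v∈U+⟨g⟩ : U+⟨g⟩ g v
        v∈U+⟨g⟩ = subspace-spanned (U+⟨g⟩-subspace g)
          (λ l x → embed∈U+⟨g⟩ l x (p (embed l x) ≟ 0#) (l Fin.≟ l₀)) v

        a : Carrier
        a = proj₁ v∈U+⟨g⟩

        v+ag∈U : v +ᵛ a •ᵛ g ∈ U
        v+ag∈U = proj₂ v∈U+⟨g⟩

        apg≈0 : a * p g ≈ 0#
        apg≈0 = begin
          a * p g            ≈⟨ p.•-homo a g ⟨
          p (a •ᵛ g)         ≈⟨ +-identityˡ _ ⟨
          0# + p (a •ᵛ g)    ≈⟨ +-congʳ pv≈0 ⟨
          p v + p (a •ᵛ g)   ≈⟨ p.+-homo v (a •ᵛ g) ⟨
          p (v +ᵛ a •ᵛ g)    ≈⟨ U⊆ker v+ag∈U ⟩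
          0#                 ∎

        a≈0 : a ≈ 0#
        a≈0 = decidable-stable (a ≟ 0#) λ a≉0 → *≉0 a≉0 pg≉0 apg≈0

-- Projective spans as linear subspaces

module ProjectiveSpan {c ℓ q} (F : FiniteField c ℓ q) where
  open FiniteField F hiding (zero; _^_)
  open LinearAlgebra commutativeRing
  open LinearAlgebraProperties commutativeRing
  open Projective F
  open FiniteVectors F

  -- The counterpart of `⟨_⟩` for vectors. It also contains 0 and is thus a subspace; at the
  -- representative of a point it unfolds to `⟨_⟩`.
  Span : ∀ {n p} → Pred (PG n) p → Pred (Vector Carrier n) (c ⊔ ℓ ⊔ p)
  Span {n} S v = ∃[ k ] Σ[ Q ∈ (Fin k → PG n) ] (∀ i → Q i ∈ S) × v ∈ rowsp (rep ∘ Q)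

  module _ {n s} {S : Pred (PG n) s} where
    private
      ∷-closed : ∀ {P u} a → P ∈ S → u ∈ Span S → a •ᵛ rep P +ᵛ u ∈ Span S
      ∷-closed {P} a P∈S (k , Q , Q∈S , x , u≋xQ) =
        suc k , P ∷ Q , (λ { zero → P∈S ; (suc i) → Q∈S i }) , a ∷ x , λ i → +-congˡ (u≋xQ i)

      resp : ∀ {u v} → u ≋ v → u ∈ Span S → v ∈ Span S
      resp u≋v (k , Q , Q∈S , x , u≋xQ) = k , Q , Q∈S , x , λ i → trans (sym (u≋v i)) (u≋xQ i)

      -- Adding the points of the first family one at a time avoids concatenating two index sets.
      combination-+-closed : ∀ {k} (Q : Fin k → PG n) → (∀ i → Q i ∈ S) → ∀ x {v} → v ∈ Span S →
                             (x ·ᴹ (rep ∘ Q)) +ᵛ v ∈ Span S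
      combination-+-closed {zero}  Q Q∈S x v∈S = resp (λ i → sym (+-identityˡ _)) v∈S
      combination-+-closed {suc k} Q Q∈S x v∈S = resp (λ i → sym (+-assoc _ _ _))
        (∷-closed (x zero) (Q∈S zero) (combination-+-closed (Q ∘ suc) (Q∈S ∘ suc) (x ∘ suc) v∈S))

    Span-subspace : IsSubspace (Span S)
    Span-subspace = record
      { resp     = resp
      ; 0ᵛ∈      = 0 , (λ ()) , (λ ()) , (λ ()) , λ _ → refl
      ; +-closed = λ { (k , Q , Q∈S , x , u≋xQ) v∈S →
          resp (λ i → +-congʳ (sym (u≋xQ i))) (combination-+-closed Q Q∈S x v∈S) }
      ; •-closed = λ { a (k , Q , Q∈S , x , u≋xQ) → k , Q , Q∈S , a •ᵛ x ,
          λ i → trans (*-congˡ (u≋xQ i)) (sym (•-·ᴹ-assoc a x (rep ∘ Q) i)) }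
      }

    point∈Span : ∀ P → P ∈ S → rep P ∈ Span S
    point∈Span P P∈S = resp (λ i → trans (+-identityʳ _) (*-identityˡ _))
      (∷-closed 1# P∈S (IsSubspace.0ᵛ∈ Span-subspace))

  rep∈⇒∈projectivization : ∀ {n p} {T : Pred (Vector Carrier n) p} P → rep P ∈ T → P ∈ projectivization T
  rep∈⇒∈projectivization P P∈T = rep P , rep≉0 P , P∈T , 1# , 1≉0 , λ i → sym (*-identityˡ _)

  ∈projectivization⇒rep∈ : ∀ {m n} {B : Matrix m n} P → P ∈ projectivization (rowsp B) → rep P ∈ rowsp B
  ∈projectivization⇒rep∈ {B = B} P (v , _ , (x , v≋xB) , a , _ , P≋av) =
    a •ᵛ x , λ i → trans (P≋av i) (trans (*-congˡ (v≋xB i)) (sym (•-·ᴹ-assoc a x B i)))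

  module _ {n s h} {T : Pred (Vector Carrier n) s} {H : Pred (PG n) h}
           {B : Matrix (n ∸ 1) n} (H≐B : H ≐ projectivization (rowsp B)) where

    Span⊆hyperplane : ∀ {v} → v ∈ Span (projectivization T ∩ H) → v ∈ rowsp B
    Span⊆hyperplane (k , Q , Q∈ , x , v≋xQ) =
      let y , xQ≋yB = rowsp-·ᴹ {A = rep ∘ Q}
            (λ i → ∈projectivization⇒rep∈ (Q i) (proj₁ H≐B {Q i} (proj₂ (Q∈ i)))) x
      in y , λ i → trans (v≋xQ i) (xQ≋yB i)

    ∈Span : ∀ {v} → v ∈ T → v ∈ rowsp B → v ∈ Span (projectivization T ∩ H)
    ∈Span {v} v∈T v∈B with v ≋? 0ᵛ
    -- The zero vector represents no point, so it enters as the empty combination.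
    ... | yes v≋0 = resp (λ i → sym (v≋0 i)) 0ᵛ∈
      where open IsSubspace (Span-subspace {S = projectivization T ∩ H})
    ... | no v≉0  = point∈Span [ v , v≉0 ]
      (rep∈⇒∈projectivization [ v , v≉0 ] v∈T , proj₂ H≐B {[ v , v≉0 ]} (rep∈⇒∈projectivization [ v , v≉0 ] v∈B))

-- Field reduction and linear forms twisted by `φ`

module ReductionProperties {c₁ ℓ₁ c₂ ℓ₂ q r}
  (F : FiniteField c₁ ℓ₁ q) (K : FiniteField c₂ ℓ₂ (q ℕ.^ r))
  (ι : FiniteField.Carrier F → FiniteField.Carrier K)
  (ι-embedding : Reduction.IsFieldEmbedding {r = r} F K ι)
  (M : LinearAlgebra.Matrix (FiniteField.commutativeRing F) r r)
  (φ : FiniteField.Carrier K → LinearAlgebra.Matrix (FiniteField.commutativeRing F) r r)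
  (φ-isomorphism : Reduction.IsAlgebraIsomorphism {r = r} F K ι M φ)
  where

  private
    module F = FiniteField F
    module K = FiniteField K
  open LinearAlgebra F.commutativeRing
  open Reduction {r = r} F K
  private
    module KL = LinearAlgebra K.commutativeRing
    module KP = FieldProperties K
    module FP = FieldProperties F
    module ι = IsRingHomomorphism ι-embedding
    module φ where
      open IsAlgebraIsomorphism φ-isomorphism public
      open IsRingMonomorphism isRingMonomorphism public
  open LinearAlgebraProperties F.commutativeRing
  open FiniteVectors F

  ι-^ : ∀ c m → ι c K.^ m K.≈ ι (c F.^ m)
  ι-^ c zero    = K.sym ι.1#-homo
  ι-^ c (suc m) = K.trans (K.*-congˡ (ι-^ c m)) (K.sym (ι.*-homo c (c F.^ m)))

  ι-fermat : ∀ {c} → ¬ c F.≈ F.0# → ι c K.^ (q ∸ 1) K.≈ K.1#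
  ι-fermat {c} c≉0 = K.trans (ι-^ c (q ∸ 1)) (K.trans (ι.⟦⟧-cong (FP.fermat c c≉0)) ι.1#-homo)

  -- Raising both sides to the power q - 1 turns the scalars from F into 1 and leaves an equality of
  -- two powers of `γ`.
  primitive-ratio : ∀ {γ} → IsPrimitive γ → ∀ {c₁ c₂} → ¬ c₁ F.≈ F.0# → ¬ c₂ F.≈ F.0# → ∀ a b →
                    ι c₁ K.* γ K.^ a K.≈ ι c₂ K.* γ K.^ b → q ℕ.^ r ∸ 1 ∣ ℕ.∣ a - b ∣ ℕ.* (q ∸ 1)
  primitive-ratio {γ} (γ≉0 , generates) {c₁} {c₂} c₁≉0 c₂≉0 a b eq =
    ≡.subst (q ℕ.^ r ∸ 1 ∣_) (≡.sym (ℕ.*-distribʳ-∣-∣ (q ∸ 1) a b))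
      (KP.^-injective-mod γ γ≉0 generates (a ℕ.* (q ∸ 1)) (b ℕ.* (q ∸ 1)) (begin
        γ K.^ (a ℕ.* (q ∸ 1))             ≈⟨ power c₁≉0 a ⟨
        (ι c₁ K.* γ K.^ a) K.^ (q ∸ 1)    ≈⟨ Exp.^-congˡ K.commutativeSemiring (q ∸ 1) eq ⟩
        (ι c₂ K.* γ K.^ b) K.^ (q ∸ 1)    ≈⟨ power c₂≉0 b ⟩
        γ K.^ (b ℕ.* (q ∸ 1))             ∎))
    where
    open SetoidReasoning K.setoid
    power : ∀ {c} → ¬ c F.≈ F.0# → ∀ a → (ι c K.* γ K.^ a) K.^ (q ∸ 1) K.≈ γ K.^ (a ℕ.* (q ∸ 1))
    power {c} c≉0 a = begin
      (ι c K.* γ K.^ a) K.^ (q ∸ 1)             ≈⟨ Exp.^-distrib-* K.commutativeSemiring (ι c) (γ K.^ a) (q ∸ 1) ⟩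
      ι c K.^ (q ∸ 1) K.* (γ K.^ a) K.^ (q ∸ 1) ≈⟨ K.*-congʳ (ι-fermat c≉0) ⟩
      K.1# K.* (γ K.^ a) K.^ (q ∸ 1)            ≈⟨ K.*-identityˡ _ ⟩
      (γ K.^ a) K.^ (q ∸ 1)                     ≈⟨ Exp.^-assocʳ K.commutativeSemiring γ a (q ∸ 1) ⟩
      γ K.^ (a ℕ.* (q ∸ 1))                     ∎

  ·φ-+ : ∀ x α β → x ·ᴹ φ (α K.+ β) ≋ (x ·ᴹ φ α) +ᵛ (x ·ᴹ φ β)
  ·φ-+ x α β k = F.trans (·ᴹ-congʳ x (φ.+-homo α β) k) (·ᴹ-distribˡ-+ x (φ α) (φ β) k)

  ·φ-* : ∀ x α β → x ·ᴹ φ (α K.* β) ≋ x ·ᴹ φ α ·ᴹ φ β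
  ·φ-* x α β k = F.trans (·ᴹ-congʳ x (φ.*-homo α β) k) (F.sym (·ᴹ-assoc x (φ α) (φ β) k))

  ·φ-ι : ∀ x c α → x ·ᴹ φ (ι c K.* α) ≋ c •ᵛ (x ·ᴹ φ α)
  ·φ-ι x c α k = F.trans (·ᴹ-congʳ x (φ.linear c α) k) (·ᴹ-•ᴹ c x (φ α) k)

  ·φ-1 : ∀ x → x ·ᴹ φ K.1# ≋ x
  ·φ-1 x k = F.trans (·ᴹ-congʳ x φ.1#-homo k) (·ᴹ-identityʳ x k)

  ·φ-0 : ∀ x → x ·ᴹ φ K.0# ≋ 0ᵛ
  ·φ-0 x k = F.trans (·ᴹ-congʳ x φ.0#-homo k) (·ᴹ-zeroʳ x k)

  ·φ-e : ∀ {t} (l m : Fin t) x → x ·ᴹ φ (KL.e l m) ≋ e l m •ᵛ x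
  ·φ-e l m x k with l Fin.≟ m
  ... | yes _ = F.trans (·φ-1 x k) (F.sym (F.*-identityˡ (x k)))
  ... | no _  = F.trans (·φ-0 x k) (F.sym (F.zeroˡ (x k)))

  module _ {s : Vector F.Carrier r → F.Carrier} (s-linear : IsLinearForm s)
           {x : Vector F.Carrier r} (sx≉0 : ¬ s x F.≈ F.0#) where
    private
      module s = IsLinearForm s-linear

    -- For nonzero `δ` the matrix `φ δ` is invertible, so `x` would be a value of multiplication by
    -- it, forcing s(x) = 0.
    ∘φ-injective : ∀ δ → (∀ y → s (y ·ᴹ φ δ) F.≈ F.0#) → δ K.≈ K.0#
    ∘φ-injective δ sδ≈0 = decidable-stable (δ KP.≟ K.0#) λ δ≉0 →
      let δ⁻¹ , δδ⁻¹≈1 = K.inverse δ δ≉0 in sx≉0 (begin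
        s x                       ≈⟨ s.cong (·φ-1 x) ⟨
        s (x ·ᴹ φ K.1#)           ≈⟨ s.cong (·ᴹ-congʳ x (φ.⟦⟧-cong (K.trans (K.*-comm δ⁻¹ δ) δδ⁻¹≈1))) ⟨
        s (x ·ᴹ φ (δ⁻¹ K.* δ))    ≈⟨ s.cong (·φ-* x δ⁻¹ δ) ⟩
        s (x ·ᴹ φ δ⁻¹ ·ᴹ φ δ)     ≈⟨ sδ≈0 (x ·ᴹ φ δ⁻¹) ⟩
        F.0#                      ∎)
      where open SetoidReasoning F.setoid

    module _ {p : Vector F.Carrier r → F.Carrier} where

      proportional≉0 : ∀ {α c} → ¬ α K.≈ K.0# → (∀ y → s (y ·ᴹ φ α) F.≈ c F.* p y) → ¬ c F.≈ F.0#
      proportional≉0 {α} α≉0 sα≈cp c≈0 = α≉0 (∘φ-injective α λ y →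
        F.trans (sα≈cp y) (F.trans (F.*-congʳ c≈0) (F.zeroˡ (p y))))

      -- Composing `s` with either side gives the form a b p. The difference of the two sides is
      -- therefore annihilated, and `∘φ-injective` applies.
      proportional-unique : ∀ {α β a b} →
        (∀ y → s (y ·ᴹ φ α) F.≈ a F.* p y) → (∀ y → s (y ·ᴹ φ β) F.≈ b F.* p y) →
        ι b K.* α K.≈ ι a K.* β
      proportional-unique {α} {β} {a} {b} sα≈ap sβ≈bp = KP.x∙y⁻¹≈ε⇒x≈y _ _ (K.trans
        (K.+-congˡ (K.trans (KP.-‿distribˡ-* (ι a) β) (K.*-congʳ (K.sym (ι.-‿homo a)))))
        (∘φ-injective (ι b K.* α K.+ ι (F.- a) K.* β) λ y → begin
          s (y ·ᴹ φ (ι b K.* α K.+ ι (F.- a) K.* β))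
            ≈⟨ s.cong (·φ-+ y _ _) ⟩
          s ((y ·ᴹ φ (ι b K.* α)) +ᵛ (y ·ᴹ φ (ι (F.- a) K.* β)))
            ≈⟨ s.cong (λ k → F.+-cong (·φ-ι y b α k) (·φ-ι y (F.- a) β k)) ⟩
          s ((b •ᵛ (y ·ᴹ φ α)) +ᵛ (F.- a) •ᵛ (y ·ᴹ φ β))
            ≈⟨ s.-•-homo _ a _ ⟩
          s (b •ᵛ (y ·ᴹ φ α)) F.- a F.* s (y ·ᴹ φ β)
            ≈⟨ F.+-cong (F.trans (s.•-homo b _) (F.*-congˡ (sα≈ap y)))
                 (F.-‿cong (F.*-congˡ (sβ≈bp y))) ⟩
          b F.* (a F.* p y) F.- a F.* (b F.* p y)
            ≈⟨ F.+-congʳ (x∙yz≈y∙xz b a (p y)) ⟩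
          a F.* (b F.* p y) F.- a F.* (b F.* p y)
            ≈⟨ F.-‿inverseʳ _ ⟩
          F.0# ∎))
        where
        open SetoidReasoning F.setoid
        open CommutativeSemigroupProperties F.*-commutativeSemigroup using (x∙yz≈y∙xz)

  -- With `p` and `s` the restrictions of a form to blocks l and m, the vector `y` and its image
  -- under the chosen power of `γ` make up an element of `𝒯` in the kernel, nontrivial on block l.
  mixedKernel : ∀ {γ} → IsPrimitive γ → ∀ {a b} → ¬ (q ℕ.^ r ∸ 1 ∣ ℕ.∣ b - a ∣ ℕ.* (q ∸ 1)) →
    ∀ {p s} → IsLinearForm p → IsLinearForm s → ∀ {x z} → ¬ p x F.≈ F.0# → ¬ s z F.≈ F.0# →
    ∃[ y ] ¬ p y F.≈ F.0# ×
      (p y F.+ s (y ·ᴹ φ (γ K.^ a)) F.≈ F.0# ⊎ p y F.+ s (y ·ᴹ φ (γ K.^ b)) F.≈ F.0#)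
  mixedKernel {γ} γ-primitive {a} {b} ∤ {p} {s} p-linear s-linear px≉0 sz≉0 =
    decide (proportional p-linear (∘·ᴹ-isLinearForm s-linear (φ (γ K.^ a))) px≉0)
             (proportional p-linear (∘·ᴹ-isLinearForm s-linear (φ (γ K.^ b))) px≉0)
    where
    γ^≉0 : ∀ m → ¬ γ K.^ m K.≈ K.0#
    γ^≉0 = KP.^≉0 (proj₁ γ-primitive)

    Kernel : ℕ → Vector F.Carrier r → Set ℓ₁
    Kernel m y = p y F.+ s (y ·ᴹ φ (γ K.^ m)) F.≈ F.0#

    Proportional : ℕ → Set _
    Proportional m = ∃[ c ] ∀ y → s (y ·ᴹ φ (γ K.^ m)) F.≈ c F.* p y

    decide : (∃[ y ] ¬ p y F.≈ F.0# × Kernel a y) ⊎ Proportional a →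
               (∃[ y ] ¬ p y F.≈ F.0# × Kernel b y) ⊎ Proportional b →
               ∃[ y ] ¬ p y F.≈ F.0# × (Kernel a y ⊎ Kernel b y)
    decide (inj₁ (y , py≉0 , eq)) _                       = y , py≉0 , inj₁ eq
    decide (inj₂ _)               (inj₁ (y , py≉0 , eq))  = y , py≉0 , inj₂ eq
    decide (inj₂ (c , sγᵃ≈cp))    (inj₂ (d , sγᵇ≈dp))     = contradiction
      (primitive-ratio γ-primitive
        (proportional≉0 s-linear sz≉0 (γ^≉0 a) sγᵃ≈cp)
        (proportional≉0 s-linear sz≉0 (γ^≉0 b) sγᵇ≈dp)
        b a
        (proportional-unique s-linear sz≉0 sγᵇ≈dp sγᵃ≈cp))
      ∤

  module _ (t : ℕ) where
    open BlockVectors F t r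

    embed∈φ̄P : ∀ l x → embed l x ∈ φ̄ φ P[ l ]
    embed∈φ̄P l x = x , λ k → F.sym (·φ-e l (proj₂ (quotRem {t} r k)) x (proj₁ (quotRem {t} r k)))

    embed+embed∈φ̄Q : ∀ γ {l m} (l<m : l Fin.< m) i x →
                     embed l x +ᵛ embed m (x ·ᴹ φ (γ K.^ i)) ∈ φ̄ φ (Q γ l m l<m i)
    embed+embed∈φ̄Q γ {l} {m} l<m i x = x , λ k →
      let b , n = quotRem {t} r k in F.sym (F.trans
        (·φ-+ x (KL.e l n) (γ K.^ i K.* KL.e m n) b)
        (F.+-cong (·φ-e l n x b)
          (F.trans (·φ-* x (γ K.^ i) (KL.e m n) b) (·φ-e m n (x ·ᴹ φ (γ K.^ i)) b))))

-- The cutting property of the projectivization of `𝒯`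

module CuttingBlockingSet {c₁ ℓ₁ c₂ ℓ₂ q r}
  (F : FiniteField c₁ ℓ₁ q) (K : FiniteField c₂ ℓ₂ (q ℕ.^ r))
  (ι : FiniteField.Carrier F → FiniteField.Carrier K)
  (ι-embedding : Reduction.IsFieldEmbedding {r = r} F K ι)
  (M : LinearAlgebra.Matrix (FiniteField.commutativeRing F) r r)
  (φ : FiniteField.Carrier K → LinearAlgebra.Matrix (FiniteField.commutativeRing F) r r)
  (φ-isomorphism : Reduction.IsAlgebraIsomorphism {r = r} F K ι M φ)
  (γ : FiniteField.Carrier K) (γ-primitive : Reduction.IsPrimitive {r = r} F K γ)
  (t : ℕ) (i j : Fin t → Fin t → ℕ)
  (∤∣j-i∣ : ∀ l m → l Fin.< m → ¬ (q ℕ.^ r ∸ 1 ∣ ℕ.∣ j l m - i l m ∣ ℕ.* (q ∸ 1)))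
  where

  private
    module F = FiniteField F
    module K = FiniteField K
  open LinearAlgebra F.commutativeRing
  open Projective F
  open Reduction {r = r} F K
  open LinearAlgebraProperties F.commutativeRing
  open FiniteVectors F
  open BlockVectors F t r
  open ProjectiveSpan F
  open ReductionProperties F K ι ι-embedding M φ φ-isomorphism

  module _ {u} {U : Pred (Vector F.Carrier (t ℕ.* r)) u} (U-subspace : IsSubspace U) where
    private
      module U = IsSubspace U-subspace

    embed∈𝒯 : ∀ l x → embed l x ∈ 𝒯 φ γ i j
    embed∈𝒯 l x = inj₁ (l , embed∈φ̄P t l x)

    kernel⊆ : ∀ {p} → IsLinearForm p → (∀ {v} → v ∈ U → p v F.≈ F.0#) →
              (∀ {v} → v ∈ 𝒯 φ γ i j → p v F.≈ F.0# → v ∈ U) →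
              ∀ l x → ¬ p (embed l x) F.≈ F.0# → ∀ {v} → p v F.≈ F.0# → v ∈ U
    kernel⊆ {p} p-linear U⊆ker 𝒯∩ker⊆U l₀ x₀ pg≉0 pv≈0 = kernel-spanned p-linear U-subspace U⊆ker
      (λ l x → 𝒯∩ker⊆U (embed∈𝒯 l x)) mixed∈U l₀ x₀ pg≉0 pv≈0
      where
      module p = IsLinearForm p-linear

      -- `𝒯` has mixed vectors only for l < m. The equation between the two values of `p` is
      -- returned as well, so that the roles of the blocks can be exchanged afterwards.
      ordered : ∀ {l m} → l Fin.< m → ∀ x z → ¬ p (embed l x) F.≈ F.0# → ¬ p (embed m z) F.≈ F.0# →
                ∃[ x′ ] ∃[ z′ ] ¬ p (embed l x′) F.≈ F.0# ×
                  p (embed l x′) F.+ p (embed m z′) F.≈ F.0# × embed l x′ +ᵛ embed m z′ ∈ U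
      ordered {l} {m} l<m x z px≉0 pz≉0 with mixedKernel γ-primitive {i l m} {j l m} (∤∣j-i∣ l m l<m)
        (∘embed-isLinearForm p-linear l) (∘embed-isLinearForm p-linear m) {x} {z} px≉0 pz≉0
      ... | y , py≉0 , inj₁ eq = y , y ·ᴹ φ (γ K.^ i l m) , py≉0 , eq , 𝒯∩ker⊆U
        (inj₂ (l , m , l<m , inj₁ (embed+embed∈φ̄Q t γ l<m (i l m) y))) (F.trans (p.+-homo _ _) eq)
      ... | y , py≉0 , inj₂ eq = y , y ·ᴹ φ (γ K.^ j l m) , py≉0 , eq , 𝒯∩ker⊆U
        (inj₂ (l , m , l<m , inj₂ (embed+embed∈φ̄Q t γ l<m (j l m) y))) (F.trans (p.+-homo _ _) eq)

      mixed∈U : ∀ l m x z → l ≢ m → ¬ p (embed l x) F.≈ F.0# → ¬ p (embed m z) F.≈ F.0# →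
                ∃[ x′ ] ∃[ z′ ] ¬ p (embed l x′) F.≈ F.0# × embed l x′ +ᵛ embed m z′ ∈ U
      mixed∈U l m x z l≢m px≉0 pz≉0 with Fin.<-cmp l m
      ... | tri< l<m _ _ = let x′ , z′ , px′≉0 , _ , ∈U = ordered l<m x z px≉0 pz≉0 in x′ , z′ , px′≉0 , ∈U
      ... | tri≈ _ l≡m _ = contradiction l≡m l≢m
      -- Here the component known to be nonzero under `p` sits in block `m`; since the two values of
      -- `p` sum to 0, the one in block `l` is nonzero too.
      ... | tri> _ _ m<l with ordered m<l z x pz≉0 px≉0
      ...   | z′ , x′ , pz′≉0 , eq , ∈U =
        x′ , z′
        , (λ px′≈0 → pz′≉0 (F.trans (F.sym (F.+-identityʳ _)) (F.trans (F.+-congˡ (F.sym px′≈0)) eq)))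
        , U.resp (λ k → F.+-comm _ _) ∈U

    -- A block vector outside the row space turns the hyperplane into the kernel of a form and
    -- supplies the pivot. If there is none, all block vectors are in `U`, which is then everything.
    rowsp⊆ : ∀ {B} → LinearlyIndependent B → (∀ {v} → v ∈ U → v ∈ rowsp B) →
             (∀ {v} → v ∈ 𝒯 φ γ i j → v ∈ rowsp B → v ∈ U) → ∀ {v} → v ∈ rowsp B → v ∈ U
    rowsp⊆ {B} independent U⊆B 𝒯∩B⊆U {v} v∈B with Fin.any? (λ l →
      anyVector? {P = λ x → embed l x ∉ rowsp B}
        (λ { x≋y x∉B (w , y≋wB) → x∉B (w , λ k → F.trans (embed-cong l x≋y k) (y≋wB k)) })
        (λ x → ¬? (rowsp? B (embed l x))))
    ... | no none = subspace-spanned U-subspace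
      (λ l x → 𝒯∩B⊆U (embed∈𝒯 l x) (decidable-stable (rowsp? B (embed l x)) λ ∉B → none (l , x , ∉B))) v
    ... | yes (l , x , g∉B) with hyperplaneForm independent g∉B
    ...   | p , p-linear , pg≈1 , ker⊆B , B⊆ker = kernel⊆ p-linear
      (λ v∈U → B⊆ker (U⊆B v∈U)) (λ v∈𝒯 pv≈0 → 𝒯∩B⊆U v∈𝒯 (ker⊆B pv≈0)) l x
      (λ pg≈0 → F.1≉0 (F.trans (F.sym pg≈1) pg≈0)) (B⊆ker v∈B)

  cutting : IsCuttingBlockingSet (projectivization (𝒯 φ γ i j))
  cutting H (B , independent , H≐B) =
    (λ {P} P∈Span → proj₂ H≐B {P} (rep∈⇒∈projectivization P (Span⊆hyperplane H≐B P∈Span))) ,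
    (λ {P} P∈H → rowsp⊆ (Span-subspace {S = projectivization (𝒯 φ γ i j) ∩ H})
      independent (Span⊆hyperplane H≐B) (∈Span H≐B)
      (∈projectivization⇒rep∈ P (proj₁ H≐B {P} P∈H)))

open import Data.Nat.Base using (_^_; _*_)

theorem4p2 :
    ∀ {c₁ ℓ₁ c₂ ℓ₂} (q r t : ℕ) (pp : IsPrimePower q) → 1 < r → 1 ≤ t →
    (F : FiniteField c₁ ℓ₁ q) (K : FiniteField c₂ ℓ₂ (q ^ r)) →
    let module F = FiniteField F
        module K = FiniteField K
        open LinearAlgebra F.commutativeRing
        open Projective F
        open Reduction {r = r} F K
    in
    (ι : F.Carrier → K.Carrier) → IsFieldEmbedding ι →
    (γ : K.Carrier) → IsPrimitive γ →
    (f : Vector F.Carrier r) → IsMinimalPolynomial ι γ f →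
    (φ : K.Carrier → Matrix r r) → IsAlgebraIsomorphism ι (companion f) φ →
    φ γ ≋ᴹ companion f →
    (i j : Fin t → Fin t → ℕ) →
    (∀ l m → l Fin.< m → (1 ≤ i l m × i l m ≤ q ^ r ∸ 1) × (1 ≤ j l m × j l m ≤ q ^ r ∸ 1)) →
    (∀ l m → l Fin.< m → ∀ s → 1 < s → s ∣ r →
      ¬ ((+ (j l m) ℤ.- + (i l m)) ≡ + 0 [mod [ q ^ s -1]/[q-1] pp ])) →
    IsCuttingBlockingSet {n = t * r} (projectivization (𝒯 φ γ i j))
theorem4p2 q r t pp 1<r _ F K ι ι-embedding γ γ-primitive f _ φ φ-isomorphism _ i j _ ≢-mod =
  CuttingBlockingSet.cutting F K ι ι-embedding (companion f) φ φ-isomorphism γ γ-primitive t i j λ l m l<m q^r-1∣ →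
    -- The divisor s = r is admissible because 1 < r. The congruence to 0 is rewritten as
    -- divisibility of the distance between the two exponents.
    ≢-mod l m l<m r 1<r ℕ.∣-refl (≡.subst ([ q ^ r -1]/[q-1] pp ∣_)
      (≡.sym (≡.trans (≡.cong ℤ.∣_∣ (ℤ.+-identityʳ (+ j l m ℤ.- + i l m))) (∣+m-+n∣≡∣m-n∣ (j l m) (i l m))))
      (∣-[q^s-1]/[q-1] pp r ℕ.∣ j l m - i l m ∣ q^r-1∣))
  where open LinearAlgebra (FiniteField.commutativeRing F)
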